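{- Let $k \leq n$ be positive integers. Then $\mathcal{A}_{n,k} = \mathcal{M}_{n,k}$. Moreover, the set of monomials $\mathcal{A}_{n,k}$ descends to a vector space basis of $R_{n,k}$.
   Context: For positive integers $k \le n$, $I_{n,k} \subseteq \mathbb{Q}[x_1,\dots,x_n]$ is the ideal $\langle x_1^k, \dots, x_n^k, e_n, e_{n-1}, \dots, e_{n-k+1}\rangle$, where $e_d = e_d(x_1,\dots,x_n)$ is the elementary symmetric polynomial of degree $d$, and $R_{n,k} := \mathbb{Q}[x_1,\dots,x_n]/I_{n,k}$. A shuffle of two sequences is an interleaving of them preserving the relative order of the entries of each. An $(n,k)$-staircase is a shuffle of the sequence $(0,1,\dots,k-1)$ and the sequence $(k-1,k-1,\dots,k-1)$ having $n-k$ entries. $\mathcal{A}_{n,k}$ (the $(n,k)$-Artin monomials) is the set of monomials $x_1^{a_1}\cdots x_n^{a_n}$ such that $(a_1,\dots,a_n)$ is componentwise $\leq$ some $(n,k)$-staircase. For $S = \{s_1 < \cdots < s_m\} \subseteq [n]=\{1,\dots,n\}$, the skip monomial is $\mathbf{x}(S) := x_{s_1}^{s_1} x_{s_2}^{s_2-1} \cdots x_{s_m}^{s_m-m+1}$. $\mathcal{M}_{n,k}$ (the $(n,k)$-nonskip monomials) is the set of monomials $m \in \mathbb{Q}[x_1,\dots,x_n]$ such that $\mathbf{x}(S) \nmid m$ for all $S \subseteq [n]$ with $|S| = n-k+1$, and $x_i^k \nmid m$ for all $1 \le i \le n$. -}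

module Defs where

open import Algebra.Bundles using (CommutativeRing; Semiring)
import Algebra.Definitions.RawSemiring as RawSemiringDefinitions
open import Algebra.Module.Bundles using (Module)
open import Algebra.Module.Structures.Biased using (IsModuleFromLeft)
open import Algebra.Morphism.Structures using (module RingMorphisms)
open import Algebra.Morphism.Construct.Composition using (isRingHomomorphism)
import Algebra.Properties.AbelianGroup as AbelianGroupProperties
import Algebra.Properties.CommutativeSemigroup as CommutativeSemigroupProperties
import Algebra.Properties.Ring as RingProperties
open import Data.Bool.Base using (if_then_else_)
open import Data.Fin.Base using (Fin)
open import Data.Fin.Subset using (Subset; inside; outside; ∣_∣; ⁅_⁆)
open import Data.List.Base as List using (List; []; _∷_; _++_)
open import Data.List.Membership.Propositional using (_∈_)
open import Data.List.Relation.Ternary.Interleaving.Propositional using (Interleaving)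
open import Data.List.Relation.Unary.All using (All)
open import Data.List.Relation.Unary.Unique.Propositional using (Unique)
open import Data.Nat.Base as ℕ using (ℕ; zero; suc; _∸_; _≤_)
import Data.Nat.Properties as ℕₚ
open import Data.Product.Base using (_×_; _,_; ∃; ∃₂)
open import Data.Rational.Base as ℚ using (ℚ; 0ℚ; 1ℚ)
import Data.Rational.Properties as ℚₚ
open import Data.Vec.Base as Vec using (Vec; []; _∷_)
import Data.Vec.Properties as Vecₚ
open import Data.Vec.Relation.Binary.Pointwise.Inductive using (Pointwise)
open import Level using (_⊔_; 0ℓ)
import Relation.Binary.Reasoning.Setoid as SetoidReasoning
open import Relation.Nullary.Decidable.Core using (Dec; yes; no; does)
open import Relation.Nullary.Negation.Core using (¬_)
open import Relation.Unary using (Pred)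

module _ {c ℓ} (R : CommutativeRing c ℓ) where
  open CommutativeRing R

  -- The smallest ideal containing G.  Since Carrier is a setoid, an ideal
  -- must also be closed under _≈_.

  data Ideal {g} (G : Pred Carrier g) : Pred Carrier (c ⊔ ℓ ⊔ g) where
    generator : ∀ {x} → G x → Ideal G x
    zeroᴵ     : Ideal G 0#
    addᴵ      : ∀ {x y} → Ideal G x → Ideal G y → Ideal G (x + y)
    mulᴵ      : ∀ r {x} → Ideal G x → Ideal G (r * x)
    respᴵ     : ∀ {x y} → x ≈ y → Ideal G x → Ideal G y

module _ {c ℓ g} (R : CommutativeRing c ℓ) (G : Pred (CommutativeRing.Carrier R) g) where
  open CommutativeRing R hiding (zero)
  open RingProperties ring using (-1*x≈-x; -‿distribˡ-*; -‿distribʳ-*)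
  open AbelianGroupProperties +-abelianGroup
    using () renaming (⁻¹-∙-comm to -‿+-comm; ⁻¹-involutive to -‿involutive)
  open CommutativeSemigroupProperties +-commutativeSemigroup using (interchange)
  open SetoidReasoning setoid

  infix 4 _≋_
  record _≋_ (x y : Carrier) : Set (c ⊔ ℓ ⊔ g) where
    constructor congruent
    field
      difference : Ideal R G (x - y)

  private
    negᴵ : ∀ {x} → Ideal R G x → Ideal R G (- x)
    negᴵ {x} p = respᴵ (-1*x≈-x x) (mulᴵ (- 1#) p)

    ≈⇒≋ : ∀ {x y} → x ≈ y → x ≋ y
    ≈⇒≋ {x} {y} x≈y = congruent (respᴵ (begin
      0#     ≈⟨ -‿inverseʳ y ⟨
      y - y  ≈⟨ +-congʳ x≈y ⟨
      x - y  ∎) zeroᴵ)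

    telescope : ∀ x y z → (x - y) + (y - z) ≈ x - z
    telescope x y z = begin
      (x - y) + (y - z)    ≈⟨ +-assoc x (- y) (y - z) ⟩
      x + (- y + (y - z))  ≈⟨ +-congˡ (+-assoc (- y) y (- z)) ⟨
      x + ((- y + y) - z)  ≈⟨ +-congˡ (+-congʳ (-‿inverseˡ y)) ⟩
      x + (0# - z)         ≈⟨ +-congˡ (+-identityˡ (- z)) ⟩
      x - z                ∎

    ≋-sym : ∀ {x y} → x ≋ y → y ≋ x
    ≋-sym {x} {y} (congruent p) = congruent (respᴵ (begin
      - (x - y)    ≈⟨ -‿+-comm x (- y) ⟨
      - x - - y    ≈⟨ +-congˡ (-‿involutive y) ⟩
      - x + y      ≈⟨ +-comm (- x) y ⟩
      y - x        ∎) (negᴵ p))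

    ≋-trans : ∀ {x y z} → x ≋ y → y ≋ z → x ≋ z
    ≋-trans {x} {y} {z} (congruent p) (congruent q) =
      congruent (respᴵ (telescope x y z) (addᴵ p q))

    +-cong-≋ : ∀ {x y u v} → x ≋ y → u ≋ v → (x + u) ≋ (y + v)
    +-cong-≋ {x} {y} {u} {v} (congruent p) (congruent q) = congruent (respᴵ (begin
      (x - y) + (u - v)      ≈⟨ interchange x (- y) u (- v) ⟩
      (x + u) + (- y - v)    ≈⟨ +-congˡ (-‿+-comm y v) ⟩
      (x + u) - (y + v)      ∎) (addᴵ p q))

    -‿cong-≋ : ∀ {x y} → x ≋ y → (- x) ≋ (- y)
    -‿cong-≋ {x} {y} (congruent p) = congruent (respᴵ (sym (-‿+-comm x (- y))) (negᴵ p))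

    *-distribˡ-- : ∀ x y z → x * (y - z) ≈ x * y - x * z
    *-distribˡ-- x y z = begin
      x * (y - z)          ≈⟨ distribˡ x y (- z) ⟩
      x * y + x * (- z)    ≈⟨ +-congˡ (-‿distribʳ-* x z) ⟨
      x * y - x * z        ∎

    *-cong-≋ : ∀ {x y u v} → x ≋ y → u ≋ v → (x * u) ≋ (y * v)
    *-cong-≋ {x} {y} {u} {v} (congruent p) (congruent q) = congruent (respᴵ (begin
      u * (x - y) + y * (u - v)          ≈⟨ +-cong (*-distribˡ-- u x y) (*-distribˡ-- y u v) ⟩
      (u * x - u * y) + (y * u - y * v)  ≈⟨ +-congʳ (+-cong (*-comm u x) (-‿cong (*-comm u y))) ⟩
      (x * u - y * u) + (y * u - y * v)  ≈⟨ telescope (x * u) (y * u) (y * v) ⟩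
      x * u - y * v                      ∎) (addᴵ (mulᴵ u p) (mulᴵ y q)))

  quotientRing : CommutativeRing c (c ⊔ ℓ ⊔ g)
  quotientRing = record
    { Carrier = Carrier
    ; _≈_     = _≋_
    ; _+_     = _+_
    ; _*_     = _*_
    ; -_      = -_
    ; 0#      = 0#
    ; 1#      = 1#
    ; isCommutativeRing = record
      { isRing = record
        { +-isAbelianGroup = record
          { isGroup = record
            { isMonoid = record
              { isSemigroup = record
                { isMagma = record
                  { isEquivalence = record
                    { refl  = ≈⇒≋ refl
                    ; sym   = ≋-sym
                    ; trans = ≋-trans
                    }
                  ; ∙-cong = +-cong-≋
                  }
                ; assoc = λ x y z → ≈⇒≋ (+-assoc x y z)
                }
              ; identity = (λ x → ≈⇒≋ (+-identityˡ x)) , (λ x → ≈⇒≋ (+-identityʳ x))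
              }
            ; inverse = (λ x → ≈⇒≋ (-‿inverseˡ x)) , (λ x → ≈⇒≋ (-‿inverseʳ x))
            ; ⁻¹-cong = -‿cong-≋
            }
          ; comm = λ x y → ≈⇒≋ (+-comm x y)
          }
        ; *-cong     = *-cong-≋
        ; *-assoc    = λ x y z → ≈⇒≋ (*-assoc x y z)
        ; *-identity = (λ x → ≈⇒≋ (*-identityˡ x)) , (λ x → ≈⇒≋ (*-identityʳ x))
        ; distrib    = (λ x y z → ≈⇒≋ (distribˡ x y z)) , (λ x y z → ≈⇒≋ (distribʳ x y z))
        }
      ; *-comm = λ x y → ≈⇒≋ (*-comm x y)
      }
    }

  projection-isRingHomomorphism :
    RingMorphisms.IsRingHomomorphism rawRing (CommutativeRing.rawRing quotientRing) (λ x → x)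
  projection-isRingHomomorphism = record
    { isSemiringHomomorphism = record
      { isNearSemiringHomomorphism = record
        { +-isMonoidHomomorphism = record
          { isMagmaHomomorphism = record
            { isRelHomomorphism = record { cong = ≈⇒≋ }
            ; homo = λ _ _ → ≈⇒≋ refl
            }
          ; ε-homo = ≈⇒≋ refl
          }
        ; *-homo = λ _ _ → ≈⇒≋ refl
        }
      ; 1#-homo = ≈⇒≋ refl
      }
    ; -‿homo = λ _ → ≈⇒≋ refl
    }

module _ {k ℓk r ℓr} (K : CommutativeRing k ℓk) (R : CommutativeRing r ℓr) where
  private
    module K = CommutativeRing K
    module R = CommutativeRing R
  open RingMorphisms K.rawRing R.rawRing using (IsRingHomomorphism)

  restrictScalars : (φ : K.Carrier → R.Carrier) → IsRingHomomorphism φ → Module K r ℓr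
  restrictScalars φ isHom = record
    { Carrierᴹ = R.Carrier
    ; _≈ᴹ_     = R._≈_
    ; _+ᴹ_     = R._+_
    ; _*ₗ_     = λ a x → φ a R.* x
    ; _*ᵣ_     = λ x a → φ a R.* x
    ; 0ᴹ       = R.0#
    ; -ᴹ_      = R.-_
    ; isModule = IsModuleFromLeft.isModule {commutativeRing = K} record
      { isLeftModule = record
        { isLeftSemimodule = record
          { +ᴹ-isCommutativeMonoid = R.+-isCommutativeMonoid
          ; isPreleftSemimodule = record
            { *ₗ-cong      = λ p q → R.*-cong (⟦⟧-cong p) q
            ; *ₗ-zeroˡ     = λ x → R.trans (R.*-congʳ 0#-homo) (R.zeroˡ x)
            ; *ₗ-distribʳ  = λ x a b → R.trans (R.*-congʳ (+-homo a b)) (R.distribʳ x _ _)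
            ; *ₗ-identityˡ = λ x → R.trans (R.*-congʳ 1#-homo) (R.*-identityˡ x)
            ; *ₗ-assoc     = λ a b x → R.trans (R.*-congʳ (*-homo a b)) (R.*-assoc _ _ x)
            ; *ₗ-zeroʳ     = λ a → R.zeroʳ (φ a)
            ; *ₗ-distribˡ  = λ a x y → R.distribˡ (φ a) x y
            }
          }
        ; -ᴹ‿cong    = R.-‿cong
        ; -ᴹ‿inverse = R.-‿inverse
        }
      }
    }
    where open IsRingHomomorphism isHom

module _ {k ℓk m ℓm} {K : CommutativeRing k ℓk} (V : Module K m ℓm) where
  open CommutativeRing K using (Carrier; _≈_; 0#)
  open Module V

  linearCombination : ∀ {i} {I : Set i} → (I → Carrierᴹ) → (I → Carrier) → List I → Carrierᴹ
  linearCombination v a = List.foldr (λ i w → a i *ₗ v i +ᴹ w) 0ᴹ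

  -- The family (v i), with i ranging over the subset P of I, is a basis.
  -- Linear independence is that of a family, so v is in particular injective
  -- on P when K is nontrivial.

  record IsBasis {i p} {I : Set i} (P : Pred I p) (v : I → Carrierᴹ)
                 : Set (k ⊔ ℓk ⊔ m ⊔ ℓm ⊔ i ⊔ p) where
    field
      linearlyIndependent :
        ∀ (is : List I) → Unique is → All P is →
        ∀ (a : I → Carrier) → linearCombination v a is ≈ᴹ 0ᴹ →
        ∀ {i} → i ∈ is → a i ≈ 0#
      spanning :
        ∀ (w : Carrierᴹ) → ∃₂ λ (is : List I) (a : I → Carrier) →
        All P is × w ≈ᴹ linearCombination v a is

open import Relation.Binary.PropositionalEquality
  using (_≡_; _≢_; refl; sym; trans; cong; cong₂; subst; module ≡-Reasoning)

-- Monomials are represented by exponent vectors: a stands for x₁^a₁ ⋯ xₙ^aₙ.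

Monomial : ℕ → Set
Monomial = Vec ℕ

module _ {n : ℕ} where

  infixl 7 _·_

  _·_ : Monomial n → Monomial n → Monomial n
  _·_ = Vec.zipWith ℕ._+_

  _≟ᴹ_ : (a b : Monomial n) → Dec (a ≡ b)
  _≟ᴹ_ = Vecₚ.≡-dec ℕₚ._≟_

-- A polynomial is a formal sum of terms.  Repeated monomials and zero
-- coefficients are allowed, and the equality _≈ᴾ_ compares coefficients.

Polynomial : ℕ → Set
Polynomial n = List (ℚ × Monomial n)

module _ {n : ℕ} where

  -- Σ c f(a) over the terms c x^a.
  linearExtension : (Monomial n → ℚ) → Polynomial n → ℚ
  linearExtension f []            = 0ℚ
  linearExtension f ((c , a) ∷ p) = c ℚ.* f a ℚ.+ linearExtension f p

  δ : Monomial n → Monomial n → ℚ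
  δ a b = if does (a ≟ᴹ b) then 1ℚ else 0ℚ

  coefficient : Monomial n → Polynomial n → ℚ
  coefficient a = linearExtension (δ a)

  infix  4 _≈ᴾ_
  infixl 6 _+ᴾ_
  infixl 7 _*ᴾ_
  infix  8 -ᴾ_

  record _≈ᴾ_ (p q : Polynomial n) : Set where
    constructor coefficientwise
    field
      coefficients : ∀ a → coefficient a p ≡ coefficient a q

  constant : ℚ → Polynomial n
  constant c = (c , Vec.replicate n 0) ∷ []

  monomial : Monomial n → Polynomial n
  monomial a = (1ℚ , a) ∷ []

  0ᴾ 1ᴾ : Polynomial n
  0ᴾ = []
  1ᴾ = constant 1ℚ

  _+ᴾ_ : Polynomial n → Polynomial n → Polynomial n
  _+ᴾ_ = _++_

  -ᴾ_ : Polynomial n → Polynomial n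
  -ᴾ_ = List.map λ { (c , a) → ℚ.- c , a }

  _*ᴾ_ : Polynomial n → Polynomial n → Polynomial n
  _*ᴾ_ = List.cartesianProductWith λ { (c , a) (d , b) → c ℚ.* d , a · b }

module PolynomialLaws {n : ℕ} where
  private
    module ℚR = CommutativeRing ℚₚ.+-*-commutativeRing
    open RingProperties ℚR.ring using (-‿distribˡ-*)
    open AbelianGroupProperties ℚR.+-abelianGroup
      using () renaming (⁻¹-∙-comm to -‿+-comm)
    open CommutativeSemigroupProperties ℚR.+-commutativeSemigroup using (interchange)
    open ≡-Reasoning

    infix 4 _≗_
    _≗_ : Polynomial n → Polynomial n → Set
    p ≗ q = ∀ a → coefficient a p ≡ coefficient a q

  E : (Monomial n → ℚ) → Polynomial n → ℚ
  E = linearExtension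

  E-cong : ∀ {f g} → (∀ a → f a ≡ g a) → ∀ p → E f p ≡ E g p
  E-cong f≗g []            = refl
  E-cong f≗g ((c , a) ∷ p) = cong₂ (λ u v → c ℚ.* u ℚ.+ v) (f≗g a) (E-cong f≗g p)

  E-+ : ∀ f p q → E f (p +ᴾ q) ≡ E f p ℚ.+ E f q
  E-+ f []            q = sym (ℚₚ.+-identityˡ _)
  E-+ f ((c , a) ∷ p) q = begin
    c ℚ.* f a ℚ.+ E f (p +ᴾ q)       ≡⟨ cong (c ℚ.* f a ℚ.+_) (E-+ f p q) ⟩
    c ℚ.* f a ℚ.+ (E f p ℚ.+ E f q)  ≡⟨ ℚₚ.+-assoc (c ℚ.* f a) (E f p) (E f q) ⟨
    c ℚ.* f a ℚ.+ E f p ℚ.+ E f q    ∎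

  E-neg : ∀ f p → E f (-ᴾ p) ≡ ℚ.- E f p
  E-neg f []            = refl
  E-neg f ((c , a) ∷ p) = begin
    (ℚ.- c) ℚ.* f a ℚ.+ E f (-ᴾ p)    ≡⟨ cong₂ ℚ._+_ (sym (-‿distribˡ-* c (f a))) (E-neg f p) ⟩
    ℚ.- (c ℚ.* f a) ℚ.+ ℚ.- E f p     ≡⟨ -‿+-comm (c ℚ.* f a) (E f p) ⟩
    ℚ.- (c ℚ.* f a ℚ.+ E f p)         ∎

  E-zero : ∀ p → E (λ _ → 0ℚ) p ≡ 0ℚ
  E-zero []            = refl
  E-zero ((c , a) ∷ p) = cong₂ ℚ._+_ (ℚₚ.*-zeroʳ c) (E-zero p)

  E-add : ∀ f g p → E (λ a → f a ℚ.+ g a) p ≡ E f p ℚ.+ E g p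
  E-add f g []            = refl
  E-add f g ((c , a) ∷ p) = begin
    c ℚ.* (f a ℚ.+ g a) ℚ.+ E (λ b → f b ℚ.+ g b) p
      ≡⟨ cong₂ ℚ._+_ (ℚₚ.*-distribˡ-+ c (f a) (g a)) (E-add f g p) ⟩
    (c ℚ.* f a ℚ.+ c ℚ.* g a) ℚ.+ (E f p ℚ.+ E g p)
      ≡⟨ interchange (c ℚ.* f a) (c ℚ.* g a) (E f p) (E g p) ⟩
    (c ℚ.* f a ℚ.+ E f p) ℚ.+ (c ℚ.* g a ℚ.+ E g p)  ∎

  E-scale : ∀ d f p → E (λ a → d ℚ.* f a) p ≡ d ℚ.* E f p
  E-scale d f []            = sym (ℚₚ.*-zeroʳ d)
  E-scale d f ((c , a) ∷ p) = begin
    c ℚ.* (d ℚ.* f a) ℚ.+ E (λ b → d ℚ.* f b) p  ≡⟨ cong₂ ℚ._+_ swap (E-scale d f p) ⟩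
    d ℚ.* (c ℚ.* f a) ℚ.+ d ℚ.* E f p            ≡⟨ ℚₚ.*-distribˡ-+ d _ _ ⟨
    d ℚ.* (c ℚ.* f a ℚ.+ E f p)                  ∎
    where
    swap : c ℚ.* (d ℚ.* f a) ≡ d ℚ.* (c ℚ.* f a)
    swap = begin
      c ℚ.* (d ℚ.* f a)    ≡⟨ ℚₚ.*-assoc c d (f a) ⟨
      (c ℚ.* d) ℚ.* f a    ≡⟨ cong (ℚ._* f a) (ℚₚ.*-comm c d) ⟩
      (d ℚ.* c) ℚ.* f a    ≡⟨ ℚₚ.*-assoc d c (f a) ⟩
      d ℚ.* (c ℚ.* f a)    ∎

  E-swap : ∀ (h : Monomial n → Monomial n → ℚ) p q →
           E (λ a → E (h a) q) p ≡ E (λ b → E (λ a → h a b) p) q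
  E-swap h []            q = sym (E-zero q)
  E-swap h ((c , a) ∷ p) q = begin
    c ℚ.* E (h a) q ℚ.+ E (λ a′ → E (h a′) q) p
      ≡⟨ cong₂ ℚ._+_ (sym (E-scale c (h a) q)) (E-swap h p q) ⟩
    E (λ b → c ℚ.* h a b) q ℚ.+ E (λ b → E (λ a′ → h a′ b) p) q
      ≡⟨ E-add (λ b → c ℚ.* h a b) (λ b → E (λ a′ → h a′ b) p) q ⟨
    E (λ b → c ℚ.* h a b ℚ.+ E (λ a′ → h a′ b) p) q  ∎

  E-term : ∀ f c a q →
    E f (List.map (λ { (d , b) → c ℚ.* d , a · b }) q) ≡ c ℚ.* E (λ b → f (a · b)) q
  E-term f c a []            = sym (ℚₚ.*-zeroʳ c)
  E-term f c a ((d , b) ∷ q) = begin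
    (c ℚ.* d) ℚ.* f (a · b) ℚ.+ E f (List.map _ q)
      ≡⟨ cong₂ ℚ._+_ (ℚₚ.*-assoc c d (f (a · b))) (E-term f c a q) ⟩
    c ℚ.* (d ℚ.* f (a · b)) ℚ.+ c ℚ.* E (λ b′ → f (a · b′)) q
      ≡⟨ ℚₚ.*-distribˡ-+ c _ _ ⟨
    c ℚ.* (d ℚ.* f (a · b) ℚ.+ E (λ b′ → f (a · b′)) q)  ∎

  linearExtension-* : ∀ f (p q : Polynomial n) →
    linearExtension f (p *ᴾ q) ≡
    linearExtension (λ a → linearExtension (λ b → f (a · b)) q) p
  linearExtension-* f []            q = refl
  linearExtension-* f ((c , a) ∷ p) q =
    trans (E-+ f (List.map _ q) (p *ᴾ q))
          (cong₂ ℚ._+_ (E-term f c a q) (linearExtension-* f p q))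

  E-* = linearExtension-*

  ·-assoc : ∀ (a b c : Monomial n) → (a · b) · c ≡ a · (b · c)
  ·-assoc = Vecₚ.zipWith-assoc ℕₚ.+-assoc

  ·-comm : ∀ (a b : Monomial n) → a · b ≡ b · a
  ·-comm = Vecₚ.zipWith-comm ℕₚ.+-comm

  ·-identityˡ : ∀ (a : Monomial n) → Vec.replicate n 0 · a ≡ a
  ·-identityˡ = Vecₚ.zipWith-identityˡ ℕₚ.+-identityˡ

  ·-cancelˡ : ∀ {m} (a b c : Vec ℕ m) →
              Vec.zipWith ℕ._+_ a b ≡ Vec.zipWith ℕ._+_ a c → b ≡ c
  ·-cancelˡ []      []      []      eq = refl
  ·-cancelˡ (x ∷ a) (y ∷ b) (z ∷ c) eq =
    cong₂ _∷_ (ℕₚ.+-cancelˡ-≡ x y z (Vecₚ.∷-injectiveˡ eq))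
              (·-cancelˡ a b c (Vecₚ.∷-injectiveʳ eq))

  divides? : ∀ {m} (a b : Vec ℕ m) → Dec (∃ λ c → Vec.zipWith ℕ._+_ a c ≡ b)
  divides? []      []      = yes ([] , refl)
  divides? (x ∷ a) (y ∷ b) with x ℕₚ.≤? y | divides? a b
  ... | yes x≤y | yes (c , eq) = yes (y ∸ x ∷ c , cong₂ _∷_ (ℕₚ.m+[n∸m]≡n x≤y) eq)
  ... | no  x≰y | _            = no λ { (z ∷ c , eq) →
    x≰y (subst (x ≤_) (Vecₚ.∷-injectiveˡ eq) (ℕₚ.m≤m+n x z)) }
  ... | yes _   | no ¬p        = no λ { (z ∷ c , eq) → ¬p (c , Vecₚ.∷-injectiveʳ eq) }

  δ-yes : ∀ {a b : Monomial n} → a ≡ b → δ a b ≡ 1ℚ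
  δ-yes {a} {b} a≡b with a ≟ᴹ b
  ... | yes _   = refl
  ... | no  a≢b with () ← a≢b a≡b

  δ-no : ∀ {a b : Monomial n} → a ≢ b → δ a b ≡ 0ℚ
  δ-no {a} {b} a≢b with a ≟ᴹ b
  ... | yes a≡b with () ← a≢b a≡b
  ... | no  _   = refl

  δ-shift : ∀ a c b → δ (a · c) (a · b) ≡ δ c b
  δ-shift a c b with c ≟ᴹ b
  ... | yes c≡b = δ-yes (cong (a ·_) c≡b)
  ... | no  c≢b = δ-no (λ eq → c≢b (·-cancelˡ a c b eq))

  shift-cong : ∀ {q q′ : Polynomial n} → q ≗ q′ → ∀ m a →
               E (λ b → δ m (a · b)) q ≡ E (λ b → δ m (a · b)) q′
  shift-cong {q} {q′} q≈q′ m a with divides? a m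
  ... | yes (c , refl) = begin
    E (λ b → δ (a · c) (a · b)) q   ≡⟨ E-cong (δ-shift a c) q ⟩
    E (δ c) q                       ≡⟨ q≈q′ c ⟩
    E (δ c) q′                      ≡⟨ E-cong (δ-shift a c) q′ ⟨
    E (λ b → δ (a · c) (a · b)) q′  ∎
  ... | no a∤m = begin
    E (λ b → δ m (a · b)) q   ≡⟨ E-cong vanish q ⟩
    E (λ _ → 0ℚ) q            ≡⟨ trans (E-zero q) (sym (E-zero q′)) ⟩
    E (λ _ → 0ℚ) q′           ≡⟨ E-cong vanish q′ ⟨
    E (λ b → δ m (a · b)) q′  ∎
    where
    vanish : ∀ b → δ m (a · b) ≡ 0ℚ
    vanish b = δ-no λ m≡ab → a∤m (b , sym m≡ab)

  *-congˡ : ∀ p {q q′ : Polynomial n} → q ≗ q′ → p *ᴾ q ≗ p *ᴾ q′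
  *-congˡ p {q} {q′} q≈q′ m = begin
    coefficient m (p *ᴾ q)               ≡⟨ E-* (δ m) p q ⟩
    E (λ a → E (λ b → δ m (a · b)) q) p  ≡⟨ E-cong (shift-cong {q} {q′} q≈q′ m) p ⟩
    E (λ a → E (λ b → δ m (a · b)) q′) p ≡⟨ E-* (δ m) p q′ ⟨
    coefficient m (p *ᴾ q′)              ∎

  *-comm : ∀ (p q : Polynomial n) → p *ᴾ q ≗ q *ᴾ p
  *-comm p q m = begin
    coefficient m (p *ᴾ q)               ≡⟨ E-* (δ m) p q ⟩
    E (λ a → E (λ b → δ m (a · b)) q) p  ≡⟨ E-swap (λ a b → δ m (a · b)) p q ⟩
    E (λ b → E (λ a → δ m (a · b)) p) q  ≡⟨ E-cong (λ b → E-cong (λ a → cong (δ m) (·-comm a b)) p) q ⟩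
    E (λ b → E (λ a → δ m (b · a)) p) q  ≡⟨ E-* (δ m) q p ⟨
    coefficient m (q *ᴾ p)               ∎

  *-cong : ∀ {p p′ q q′ : Polynomial n} → p ≗ p′ → q ≗ q′ → p *ᴾ q ≗ p′ *ᴾ q′
  *-cong {p} {p′} {q} {q′} p≈p′ q≈q′ m = begin
    coefficient m (p *ᴾ q)    ≡⟨ *-congˡ p {q} {q′} q≈q′ m ⟩
    coefficient m (p *ᴾ q′)   ≡⟨ *-comm p q′ m ⟩
    coefficient m (q′ *ᴾ p)   ≡⟨ *-congˡ q′ {p} {p′} p≈p′ m ⟩
    coefficient m (q′ *ᴾ p′)  ≡⟨ *-comm q′ p′ m ⟩
    coefficient m (p′ *ᴾ q′)  ∎

  *-assoc : ∀ (p q r : Polynomial n) → (p *ᴾ q) *ᴾ r ≗ p *ᴾ (q *ᴾ r)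
  *-assoc p q r m = begin
    coefficient m ((p *ᴾ q) *ᴾ r)
      ≡⟨ E-* (δ m) (p *ᴾ q) r ⟩
    E (λ u → E (λ c → δ m (u · c)) r) (p *ᴾ q)
      ≡⟨ E-* (λ u → E (λ c → δ m (u · c)) r) p q ⟩
    E (λ a → E (λ b → E (λ c → δ m ((a · b) · c)) r) q) p
      ≡⟨ E-cong (λ a → E-cong (λ b → E-cong (λ c → cong (δ m) (·-assoc a b c)) r) q) p ⟩
    E (λ a → E (λ b → E (λ c → δ m (a · (b · c))) r) q) p
      ≡⟨ E-cong (λ a → E-* (λ u → δ m (a · u)) q r) p ⟨
    E (λ a → E (λ u → δ m (a · u)) (q *ᴾ r)) p
      ≡⟨ E-* (δ m) p (q *ᴾ r) ⟨
    coefficient m (p *ᴾ (q *ᴾ r))  ∎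

  *-identityˡ : ∀ (p : Polynomial n) → 1ᴾ *ᴾ p ≗ p
  *-identityˡ p m = begin
    coefficient m (1ᴾ *ᴾ p)                               ≡⟨ E-* (δ m) 1ᴾ p ⟩
    1ℚ ℚ.* E (λ b → δ m (Vec.replicate n 0 · b)) p ℚ.+ 0ℚ ≡⟨ ℚₚ.+-identityʳ _ ⟩
    1ℚ ℚ.* E (λ b → δ m (Vec.replicate n 0 · b)) p        ≡⟨ ℚₚ.*-identityˡ _ ⟩
    E (λ b → δ m (Vec.replicate n 0 · b)) p               ≡⟨ E-cong (λ b → cong (δ m) (·-identityˡ b)) p ⟩
    coefficient m p                                       ∎

  distribʳ : ∀ (r p q : Polynomial n) → (p +ᴾ q) *ᴾ r ≗ p *ᴾ r +ᴾ q *ᴾ r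
  distribʳ r p q m = begin
    coefficient m ((p +ᴾ q) *ᴾ r)                        ≡⟨ E-* (δ m) (p +ᴾ q) r ⟩
    E f (p +ᴾ q)                                         ≡⟨ E-+ f p q ⟩
    E f p ℚ.+ E f q                                      ≡⟨ cong₂ ℚ._+_ (E-* (δ m) p r) (E-* (δ m) q r) ⟨
    coefficient m (p *ᴾ r) ℚ.+ coefficient m (q *ᴾ r)    ≡⟨ E-+ (δ m) (p *ᴾ r) (q *ᴾ r) ⟨
    coefficient m (p *ᴾ r +ᴾ q *ᴾ r)                     ∎
    where
    f : Monomial n → ℚ
    f a = E (λ b → δ m (a · b)) r

  distribˡ : ∀ (r p q : Polynomial n) → r *ᴾ (p +ᴾ q) ≗ r *ᴾ p +ᴾ r *ᴾ q
  distribˡ r p q m = begin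
    coefficient m (r *ᴾ (p +ᴾ q))                      ≡⟨ *-comm r (p +ᴾ q) m ⟩
    coefficient m ((p +ᴾ q) *ᴾ r)                      ≡⟨ distribʳ r p q m ⟩
    coefficient m (p *ᴾ r +ᴾ q *ᴾ r)                   ≡⟨ E-+ (δ m) (p *ᴾ r) (q *ᴾ r) ⟩
    coefficient m (p *ᴾ r) ℚ.+ coefficient m (q *ᴾ r)  ≡⟨ cong₂ ℚ._+_ (*-comm p r m) (*-comm q r m) ⟩
    coefficient m (r *ᴾ p) ℚ.+ coefficient m (r *ᴾ q)  ≡⟨ E-+ (δ m) (r *ᴾ p) (r *ᴾ q) ⟨
    coefficient m (r *ᴾ p +ᴾ r *ᴾ q)                   ∎

  +-cong : ∀ {p p′ q q′ : Polynomial n} → p ≗ p′ → q ≗ q′ → p +ᴾ q ≗ p′ +ᴾ q′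
  +-cong {p} {p′} {q} {q′} p≈p′ q≈q′ m = begin
    coefficient m (p +ᴾ q)                    ≡⟨ E-+ (δ m) p q ⟩
    coefficient m p ℚ.+ coefficient m q       ≡⟨ cong₂ ℚ._+_ (p≈p′ m) (q≈q′ m) ⟩
    coefficient m p′ ℚ.+ coefficient m q′     ≡⟨ E-+ (δ m) p′ q′ ⟨
    coefficient m (p′ +ᴾ q′)                  ∎

  +-assoc : ∀ (p q r : Polynomial n) → (p +ᴾ q) +ᴾ r ≗ p +ᴾ (q +ᴾ r)
  +-assoc p q r m = begin
    E (δ m) ((p +ᴾ q) +ᴾ r)                 ≡⟨ E-+ (δ m) (p +ᴾ q) r ⟩
    E (δ m) (p +ᴾ q) ℚ.+ E (δ m) r          ≡⟨ cong (ℚ._+ E (δ m) r) (E-+ (δ m) p q) ⟩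
    E (δ m) p ℚ.+ E (δ m) q ℚ.+ E (δ m) r   ≡⟨ ℚₚ.+-assoc (E (δ m) p) _ _ ⟩
    E (δ m) p ℚ.+ (E (δ m) q ℚ.+ E (δ m) r) ≡⟨ cong (E (δ m) p ℚ.+_) (E-+ (δ m) q r) ⟨
    E (δ m) p ℚ.+ E (δ m) (q +ᴾ r)          ≡⟨ E-+ (δ m) p (q +ᴾ r) ⟨
    E (δ m) (p +ᴾ (q +ᴾ r))                 ∎

  +-comm : ∀ (p q : Polynomial n) → p +ᴾ q ≗ q +ᴾ p
  +-comm p q m = begin
    coefficient m (p +ᴾ q)               ≡⟨ E-+ (δ m) p q ⟩
    coefficient m p ℚ.+ coefficient m q  ≡⟨ ℚₚ.+-comm (coefficient m p) (coefficient m q) ⟩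
    coefficient m q ℚ.+ coefficient m p  ≡⟨ E-+ (δ m) q p ⟨
    coefficient m (q +ᴾ p)               ∎

  -‿inverseˡ : ∀ (p : Polynomial n) → -ᴾ p +ᴾ p ≗ 0ᴾ
  -‿inverseˡ p m = begin
    coefficient m (-ᴾ p +ᴾ p)                  ≡⟨ E-+ (δ m) (-ᴾ p) p ⟩
    coefficient m (-ᴾ p) ℚ.+ coefficient m p   ≡⟨ cong (ℚ._+ coefficient m p) (E-neg (δ m) p) ⟩
    ℚ.- coefficient m p ℚ.+ coefficient m p    ≡⟨ ℚₚ.+-inverseˡ (coefficient m p) ⟩
    0ℚ                                         ∎

  -‿cong : ∀ {p q : Polynomial n} → p ≗ q → -ᴾ p ≗ -ᴾ q
  -‿cong {p} {q} p≈q m = begin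
    coefficient m (-ᴾ p)  ≡⟨ E-neg (δ m) p ⟩
    ℚ.- coefficient m p   ≡⟨ cong ℚ.-_ (p≈q m) ⟩
    ℚ.- coefficient m q   ≡⟨ E-neg (δ m) q ⟨
    coefficient m (-ᴾ q)  ∎

  constant-+ : ∀ c d → constant {n} (c ℚ.+ d) ≗ constant c +ᴾ constant d
  constant-+ c d m = begin
    (c ℚ.+ d) ℚ.* e ℚ.+ 0ℚ               ≡⟨ cong (ℚ._+ 0ℚ) (ℚₚ.*-distribʳ-+ e c d) ⟩
    (c ℚ.* e ℚ.+ d ℚ.* e) ℚ.+ 0ℚ         ≡⟨ ℚₚ.+-assoc (c ℚ.* e) (d ℚ.* e) 0ℚ ⟩
    c ℚ.* e ℚ.+ (d ℚ.* e ℚ.+ 0ℚ)         ∎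
    where
    e : ℚ
    e = δ m (Vec.replicate n 0)

  constant-* : ∀ c d → constant {n} (c ℚ.* d) ≗ constant c *ᴾ constant d
  constant-* c d m =
    cong (λ a → (c ℚ.* d) ℚ.* δ m a ℚ.+ 0ℚ) (sym (·-identityˡ (Vec.replicate n 0)))

  constant-0 : constant {n} 0ℚ ≗ 0ᴾ
  constant-0 m = trans (ℚₚ.+-identityʳ (0ℚ ℚ.* δ m (Vec.replicate n 0))) (ℚₚ.*-zeroˡ (δ m (Vec.replicate n 0)))

polynomialRing : ℕ → CommutativeRing 0ℓ 0ℓ
polynomialRing n = record
  { Carrier = Polynomial n
  ; _≈_     = _≈ᴾ_
  ; _+_     = _+ᴾ_
  ; _*_     = _*ᴾ_
  ; -_      = -ᴾ_
  ; 0#      = 0ᴾ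
  ; 1#      = 1ᴾ
  ; isCommutativeRing = record
    { isRing = record
      { +-isAbelianGroup = record
        { isGroup = record
          { isMonoid = record
            { isSemigroup = record
              { isMagma = record
                { isEquivalence = record
                  { refl  = coefficientwise λ m → refl
                  ; sym   = λ p≈q → coefficientwise λ m → sym (coefficients p≈q m)
                  ; trans = ≈-trans
                  }
                ; ∙-cong = λ {p} {p′} {q} {q′} p≈p′ q≈q′ →
                    coefficientwise (+-cong {p} {p′} {q} {q′} (coefficients p≈p′) (coefficients q≈q′))
                }
              ; assoc = λ p q r → coefficientwise (+-assoc p q r)
              }
            ; identity = (λ p → coefficientwise λ m → refl) , (λ p → coefficientwise (+-comm p 0ᴾ))
            }
          ; inverse = (λ p → coefficientwise (-‿inverseˡ p))
                    , (λ p → ≈-trans {q = (-ᴾ p) +ᴾ p} (coefficientwise (+-comm p (-ᴾ p))) (coefficientwise (-‿inverseˡ p)))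
          ; ⁻¹-cong = λ {p} {q} p≈q → coefficientwise (-‿cong {p} {q} (coefficients p≈q))
          }
        ; comm = λ p q → coefficientwise (+-comm p q)
        }
      ; *-cong = λ {p} {p′} {q} {q′} p≈p′ q≈q′ →
          coefficientwise (*-cong {p} {p′} {q} {q′} (coefficients p≈p′) (coefficients q≈q′))
      ; *-assoc    = λ p q r → coefficientwise (*-assoc p q r)
      ; *-identity = (λ p → coefficientwise (*-identityˡ p))
                   , (λ p → ≈-trans {q = 1ᴾ *ᴾ p} (coefficientwise (*-comm p 1ᴾ)) (coefficientwise (*-identityˡ p)))
      ; distrib    = (λ p q r → coefficientwise (distribˡ p q r))
                   , (λ p q r → coefficientwise (distribʳ p q r))
      }
    ; *-comm = λ p q → coefficientwise (*-comm p q)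
    }
  }
  where
  open PolynomialLaws {n}
  open _≈ᴾ_

  ≈-trans : ∀ {p q r : Polynomial n} → p ≈ᴾ q → q ≈ᴾ r → p ≈ᴾ r
  ≈-trans p≈q q≈r = coefficientwise λ m → trans (coefficients p≈q m) (coefficients q≈r m)

constant-isRingHomomorphism : ∀ n →
  RingMorphisms.IsRingHomomorphism
    (CommutativeRing.rawRing ℚₚ.+-*-commutativeRing)
    (CommutativeRing.rawRing (polynomialRing n)) constant
constant-isRingHomomorphism n = record
  { isSemiringHomomorphism = record
    { isNearSemiringHomomorphism = record
      { +-isMonoidHomomorphism = record
        { isMagmaHomomorphism = record
          { isRelHomomorphism = record { cong = λ { refl → P.refl } }
          ; homo = λ c d → coefficientwise (constant-+ c d)
          }
        ; ε-homo = coefficientwise constant-0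
        }
      ; *-homo = λ c d → coefficientwise (constant-* c d)
      }
    ; 1#-homo = P.refl
    }
  ; -‿homo = λ c → P.refl
  }
  where
  open PolynomialLaws {n}
  module P = CommutativeRing (polynomialRing n)

module _ {n : ℕ} where
  open RawSemiringDefinitions (Semiring.rawSemiring (CommutativeRing.semiring (polynomialRing n))) public
    using () renaming (_^_ to _^ᴾ_; _∣_ to _∣ᴾ_)

  -- The exponent vector of ∏_{i ∈ S} xᵢ.
  squarefree : Subset n → Monomial n
  squarefree = Vec.map λ b → if b then 1 else 0

  x : Fin n → Polynomial n
  x i = monomial (squarefree ⁅ i ⁆)

subsets : ∀ n → List (Subset n)
subsets zero    = [] ∷ []
subsets (suc n) = List.map (inside ∷_) (subsets n) ++ List.map (outside ∷_) (subsets n)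

elementarySymmetric : ∀ n → ℕ → Polynomial n
elementarySymmetric n d =
  List.map (λ S → 1ℚ , squarefree S) (List.filter (λ S → ∣ S ∣ ℕₚ.≟ d) (subsets n))

data Generators (n k : ℕ) : Pred (Polynomial n) 0ℓ where
  power      : ∀ i → Generators n k (x i ^ᴾ k)
  elementary : ∀ d → n ∸ k ℕ.+ 1 ≤ d → d ≤ n → Generators n k (elementarySymmetric n d)

R : ℕ → ℕ → CommutativeRing 0ℓ 0ℓ
R n k = quotientRing (polynomialRing n) (Generators n k)

Rᴹ : ℕ → ℕ → Module ℚₚ.+-*-commutativeRing 0ℓ 0ℓ
Rᴹ n k = restrictScalars ℚₚ.+-*-commutativeRing (R n k) (λ c → constant c)
  (isRingHomomorphism (CommutativeRing.trans (R n k))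
    (constant-isRingHomomorphism n)
    (projection-isRingHomomorphism (polynomialRing n) (Generators n k)))

-- For 1 ≤ k ≤ n; truncated subtraction is exact then.

IsStaircase : (n k : ℕ) → Pred (Vec ℕ n) 0ℓ
IsStaircase n k s =
  Interleaving (List.upTo k) (List.replicate (n ∸ k) (k ∸ 1)) (Vec.toList s)

𝒜 : (n k : ℕ) → Pred (Monomial n) 0ℓ
𝒜 n k a = ∃ λ s → IsStaircase n k s × Pointwise _≤_ a s

-- For S = {s₁ < ⋯ < sₘ} the exponent of x_{s_j} is s_j - j + 1.  The arguments
-- i and j are the (1-based) number of the variable at the head and the index
-- of the next element of S; j ≤ i holds throughout.

skipFrom : (i j : ℕ) → ∀ {m} → Subset m → Monomial m
skipFrom i j []            = []
skipFrom i j (inside  ∷ S) = i ∸ j ℕ.+ 1 ∷ skipFrom (suc i) (suc j) S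
skipFrom i j (outside ∷ S) = 0 ∷ skipFrom (suc i) j S

skip : ∀ {n} → Subset n → Monomial n
skip = skipFrom 1 1

ℳ : (n k : ℕ) → Pred (Monomial n) 0ℓ
ℳ n k a =
  (∀ (S : Subset n) → ∣ S ∣ ≡ n ∸ k ℕ.+ 1 → ¬ (monomial (skip S) ∣ᴾ monomial a)) ×
  (∀ (i : Fin n) → ¬ (x i ^ᴾ k ∣ᴾ monomial a))

module Submission where

-- Put I_{n,k,s} = ⟨x₁^k, …, xₙ^k, e_d for d > n - s⟩, so that I_{n,k} = I_{n,k,k}, and
-- compare it with the exponent vectors below the shuffles of (0, …, s - 1) and
-- (k - 1, …, k - 1).
--
-- Spanning, by induction on n, from e_d(x₁, …, xₙ) = e_d′ + xₙ e_{d-1}′ with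
-- e_d′ = e_d(x₁, …, xₙ₋₁): multiplication by xₙ^j maps I_{n-1,k,s} into I_{n,k,s}
-- when j ≥ s, and maps I_{n-1,k,s-1} into I_{n,k,s} up to multiples of xₙ^(j+1).
--
-- Independence, by functionals that kill the ideal and are triangular on the
-- monomials for the order ≺ that compares the last exponents first.  In s
-- variables, the Vandermonde determinant pairs to 0 with the multiples of every e_d,
-- d ≥ 1, and its ≺-largest monomial is (0, …, s - 1); shifting it gives every
-- a ≤ (0, …, s - 1) as largest monomial.  A further variable is added, at any
-- position, by prescribing its exponent j < k: a multiple of e_d is then paired with
-- multiples of e_d and e_{d-1} in the old variables, so that d > n - s is kept.

open import Defs
open import Algebra.Bundles using (CommutativeRing)
open import Algebra.Definitions.RawMagma using (_,_)
import Algebra.Properties.CommutativeSemigroup as CommutativeSemigroupProperties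
import Algebra.Properties.Ring as RingProperties
open import Data.Bool.Base using (T; true; false; if_then_else_)
open import Data.Fin.Base using (Fin; zero; suc; fromℕ; fromℕ<; punchIn; punchOut)
import Data.Fin.Properties as Finₚ
open import Data.Fin.Subset using (Subset; inside; outside; ∣_∣; ⁅_⁆) renaming (⊥ to ∅)
open import Data.Fin.Subset.Properties using (∣⊥∣≡0; ∣p∣≤n)
open import Data.List.Base as List using (List; []; _∷_; _++_)
open import Data.List.Membership.Propositional using (_∈_; _∉_)
open import Data.List.Membership.Propositional.Properties
  using (∈-deduplicate⁺; ∈-deduplicate⁻; ∈-map⁺; ∈-map⁻; ∈-++⁺ˡ; ∈-++⁺ʳ)
import Data.List.Properties as Listₚ
open import Data.List.Relation.Ternary.Interleaving.Propositional using (Interleaving; []; consˡ; consʳ)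
open import Data.List.Relation.Unary.All as All using (All; []; _∷_)
import Data.List.Relation.Unary.All.Properties as Allₚ
open import Data.List.Relation.Unary.Any using (here; there)
open import Data.List.Relation.Unary.Unique.DecPropositional.Properties using (deduplicate-!)
open import Data.List.Relation.Unary.Unique.Propositional using (Unique; []; _∷_)
open import Data.Nat.Base as ℕ using (ℕ; zero; suc; _≤_; _<_; _∸_; z≤n; s≤s; s≤s⁻¹)
open import Data.Nat.Induction using (Acc; acc; <-wellFounded; <-rec)
import Data.Nat.Properties as ℕₚ
open import Data.Product.Base using (_×_; _,_; ∃; ∃₂; map₂; proj₁; proj₂)
open import Data.Rational.Base as ℚ using (ℚ; 0ℚ; 1ℚ; ½)
import Data.Rational.Properties as ℚₚ
open import Data.Rational.Solver using (module +-*-Solver)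
open import Data.Sum.Base using (_⊎_; inj₁; inj₂)
open import Data.Vec.Base as Vec using (Vec; []; _∷_; insertAt; lookup; removeAt; toList)
open import Data.Vec.Membership.Propositional using () renaming (_∈_ to _∈ᵛ_)
import Data.Vec.Properties as Vecₚ
open import Data.Vec.Relation.Binary.Pointwise.Inductive as Pointwise using (Pointwise; []; _∷_)
open import Data.Vec.Relation.Unary.All as Allᵛ using ([]; _∷_) renaming (All to Allᵛ)
import Data.Vec.Relation.Unary.All.Properties as Allᵛₚ
open import Data.Vec.Relation.Unary.AllPairs using ([]; _∷_)
open import Data.Vec.Relation.Unary.Any as Anyᵛ using (here; there)
open import Data.Vec.Relation.Unary.Unique.Propositional using () renaming (Unique to Uniqueᵛ)
open import Data.Vec.Relation.Unary.Unique.Propositional.Properties using (lookup-injective)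
open import Function.Base using (_∘_; id; case_of_)
open import Induction.WellFounded using (WellFounded)
open import Level using (0ℓ)
open import Relation.Binary.Definitions using (tri<; tri≈; tri>)
open import Relation.Binary.PropositionalEquality
open import Relation.Nullary using (¬_; yes; no; contradiction; does)
open import Relation.Nullary.Decidable using (dec-true; dec-false)
open import Relation.Unary using (Pred; _≐_)
open PolynomialLaws
open ≡-Reasoning
open RingProperties (CommutativeRing.ring ℚₚ.+-*-commutativeRing) using (-1*x≈-x)

-- Staircases and skip monomials

infix 4 _⊑_
_⊑_ : ∀ {n} → Vec ℕ n → Vec ℕ n → Set
_⊑_ = Pointwise _≤_

range : ℕ → ℕ → List ℕ
range = List.iterate suc

upTo≡range : ∀ m → List.upTo m ≡ range 0 m
upTo≡range m = go id 0 m λ _ → refl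
  where
  go : ∀ f r m → (∀ i → f i ≡ r ℕ.+ i) → List.applyUpTo f m ≡ range r m
  go f r zero    f≗ = refl
  go f r (suc m) f≗ = cong₂ _∷_ (trans (f≗ 0) (ℕₚ.+-identityʳ r))
    (go (f ∘ suc) (suc r) m λ i → trans (f≗ (suc i)) (ℕₚ.+-suc r i))

-- The shuffles of (r, r + 1, …, r + m - 1) and (c, …, c), with q entries c.
data Staircase (c : ℕ) : (r m q : ℕ) → ∀ {n} → Vec ℕ n → Set where
  []   : ∀ {r} → Staircase c r 0 0 []
  next : ∀ {r m q n} {st : Vec ℕ n} → Staircase c (suc r) m q st → Staircase c r (suc m) q (r ∷ st)
  top  : ∀ {r m q n} {st : Vec ℕ n} → Staircase c r m q st → Staircase c r m (suc q) (c ∷ st)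

module _ {c : ℕ} where

  fromInterleaving : ∀ r m q {n} (st : Vec ℕ n) →
    Interleaving (range r m) (List.replicate q c) (toList st) → Staircase c r m q st
  fromInterleaving r zero    zero    []       []         = []
  fromInterleaving r zero    (suc q) (_ ∷ st) (consʳ sh) = top (fromInterleaving r zero q st sh)
  fromInterleaving r (suc m) zero    (_ ∷ st) (consˡ sh) = next (fromInterleaving (suc r) m zero st sh)
  fromInterleaving r (suc m) (suc q) (_ ∷ st) (consˡ sh) = next (fromInterleaving (suc r) m (suc q) st sh)
  fromInterleaving r (suc m) (suc q) (_ ∷ st) (consʳ sh) = top (fromInterleaving r (suc m) q st sh)

  toInterleaving : ∀ {r m q n} {st : Vec ℕ n} → Staircase c r m q st →
    Interleaving (range r m) (List.replicate q c) (toList st)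
  toInterleaving []        = []
  toInterleaving (next sh) = consˡ (toInterleaving sh)
  toInterleaving (top sh)  = consʳ (toInterleaving sh)

  -- The increasing sequence can only advance at positions outside `S`, which preserves `r ≤ i ∸ j`
  -- for its next value `r`. At an element of `S` the skip exponent exceeds that value, so every
  -- element of `S` must sit at an entry `c`, and there are only `q` of these.
  skip≰staircase : ∀ {n r m q i j} → j ≤ i → r ≤ i ∸ j → (S : Subset n) {st : Vec ℕ n} →
    Staircase c r m q st → q < ∣ S ∣ → ¬ skipFrom i j S ⊑ st
  skip≰staircase j≤i r≤ [] [] ()
  skip≰staircase {i = i} {j} j≤i r≤ (inside ∷ S) (next sh) q< (h ∷ pw) =
    ℕₚ.<⇒≱ (ℕₚ.≤-trans (s≤s r≤) (ℕₚ.≤-reflexive (ℕₚ.+-comm 1 (i ∸ j)))) h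
  skip≰staircase j≤i r≤ (outside ∷ S) (next sh) q< (h ∷ pw) =
    skip≰staircase (ℕₚ.m≤n⇒m≤1+n j≤i)
      (ℕₚ.≤-trans (s≤s r≤) (ℕₚ.≤-reflexive (sym (ℕₚ.+-∸-assoc 1 j≤i)))) S sh q< pw
  skip≰staircase j≤i r≤ (inside ∷ S) (top sh) q< (h ∷ pw) =
    skip≰staircase (s≤s j≤i) r≤ S sh (s≤s⁻¹ q<) pw
  skip≰staircase {i = i} {j} j≤i r≤ (outside ∷ S) (top sh) q< (h ∷ pw) =
    skip≰staircase (ℕₚ.m≤n⇒m≤1+n j≤i)
      (ℕₚ.≤-trans r≤ (ℕₚ.∸-monoˡ-≤ j (ℕₚ.n≤1+n i))) S sh (ℕₚ.<-trans (ℕₚ.n<1+n _) q<) pw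

  topStaircase : ∀ {n} r (a : Vec ℕ n) → (∀ l → lookup a l ≤ c) →
    ∃ λ st → Staircase c r 0 n st × a ⊑ st
  topStaircase r []      a≤c = [] , [] , []
  topStaircase r (x ∷ a) a≤c with st , sh , a≤st ← topStaircase r a (a≤c ∘ suc) =
    c ∷ st , top sh , a≤c zero ∷ a≤st

  skipFrom-∅≤ : ∀ {n} i j (a : Vec ℕ n) → skipFrom i j ∅ ⊑ a
  skipFrom-∅≤ i j []      = []
  skipFrom-∅≤ i j (x ∷ a) = z≤n ∷ skipFrom-∅≤ (suc i) j a

  -- Greedily, a position that can take the next value of the increasing
  -- sequence takes it; all the others form a set S with skip S ≤ a.
  greedyStaircase : ∀ {n r} m q {i j : ℕ} → j ≤ i → i ∸ j ≡ r → n ≡ m ℕ.+ q → (a : Vec ℕ n) →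
    (∀ l → lookup a l ≤ c) →
    (∀ S → ∣ S ∣ ≡ suc q → ¬ skipFrom i j S ⊑ a) →
    ∃ λ st → Staircase c r m q st × a ⊑ st
  greedyStaircase zero q j≤i i∸j≡r refl a a≤c noskip = topStaircase _ a a≤c
  greedyStaircase {r = r} (suc m) q {i} {j} j≤i i∸j≡r n≡ (x ∷ a) a≤c noskip with x ℕₚ.≤? r
  ... | yes x≤r with st , sh , a≤st ← greedyStaircase m q (ℕₚ.m≤n⇒m≤1+n j≤i)
                   (trans (ℕₚ.+-∸-assoc 1 j≤i) (cong suc i∸j≡r)) (ℕₚ.suc-injective n≡) a (a≤c ∘ suc)
                   (λ S ∣S∣ p → noskip (outside ∷ S) ∣S∣ (z≤n ∷ p))
      = r ∷ st , next sh , x≤r ∷ a≤st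
  greedyStaircase {suc n} {r} (suc m) q {i} {j} j≤i i∸j≡r n≡ (x ∷ a) a≤c noskip | no x≰r = go q n≡ noskip
    where
    skip-head : i ∸ j ℕ.+ 1 ≤ x
    skip-head = ℕₚ.≤-trans (ℕₚ.≤-reflexive (trans (ℕₚ.+-comm _ 1) (cong suc i∸j≡r))) (ℕₚ.≰⇒> x≰r)

    go : ∀ q → suc n ≡ suc m ℕ.+ q →
      (∀ (S : Subset (suc n)) → ∣ S ∣ ≡ suc q → ¬ skipFrom i j S ⊑ (x ∷ a)) →
      ∃ λ (st : Vec ℕ (suc n)) → Staircase c r (suc m) q st × (x ∷ a) ⊑ st
    -- No entry `c` is left, and the head alone is already a set of `suc 0` elements whose skip
    -- vector lies below `x ∷ a`.
    go zero    n≡ noskip =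
      contradiction (skip-head ∷ skipFrom-∅≤ _ _ a) (noskip (inside ∷ ∅) (cong suc (∣⊥∣≡0 n)))
    go (suc q) n≡ noskip
      with st , sh , a≤st ← greedyStaircase (suc m) q {suc i} {suc j} (s≤s j≤i) i∸j≡r
             (trans (ℕₚ.suc-injective n≡) (ℕₚ.+-suc m q)) a (a≤c ∘ suc)
             (λ S ∣S∣ p → noskip (inside ∷ S) (cong suc ∣S∣) (skip-head ∷ p))
      = c ∷ st , top sh , a≤c zero ∷ a≤st

  staircase-≤ : ∀ {r m q n} {st : Vec ℕ n} → r ℕ.+ m ≤ suc c → Staircase c r m q st → ∀ l → lookup st l ≤ c
  staircase-≤ {r} {suc m} r+m≤ (next sh) zero    =
    ℕₚ.≤-trans (ℕₚ.m≤m+n r m) (s≤s⁻¹ (subst (_≤ suc c) (ℕₚ.+-suc r m) r+m≤))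
  staircase-≤ {r} {suc m} r+m≤ (next sh) (suc l) =
    staircase-≤ (subst (_≤ suc c) (ℕₚ.+-suc r m) r+m≤) sh l
  staircase-≤ r+m≤ (top sh) zero    = ℕₚ.≤-refl
  staircase-≤ r+m≤ (top sh) (suc l) = staircase-≤ r+m≤ sh l

-- Polynomials and elementary symmetric polynomials

⊑⇒∣ : ∀ {m} {a b : Vec ℕ m} → a ⊑ b → ∃ λ c → Vec.zipWith ℕ._+_ a c ≡ b
⊑⇒∣ []                         = [] , refl
⊑⇒∣ {a = x ∷ _} {y ∷ _} (x≤y ∷ a⊑b) with c , refl ← ⊑⇒∣ a⊑b = y ∸ x ∷ c , cong (_∷ _) (ℕₚ.m+[n∸m]≡n x≤y)

∣⇒⊑ : ∀ {m} (a c : Vec ℕ m) → a ⊑ Vec.zipWith ℕ._+_ a c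
∣⇒⊑ []      []      = []
∣⇒⊑ (x ∷ a) (y ∷ c) = ℕₚ.m≤m+n x y ∷ ∣⇒⊑ a c

≡0⇒*≡0 : ∀ {p q} → p ≡ 0ℚ → p ℚ.* q ≡ 0ℚ
≡0⇒*≡0 {q = q} p≡0 = trans (cong (ℚ._* q) p≡0) (ℚₚ.*-zeroˡ q)

≡0⇒*≡0ʳ : ∀ p {q} → q ≡ 0ℚ → p ℚ.* q ≡ 0ℚ
≡0⇒*≡0ʳ p q≡0 = trans (cong (p ℚ.*_) q≡0) (ℚₚ.*-zeroʳ p)

module _ {n : ℕ} where

  E-cong-All : ∀ {f g : Monomial n → ℚ} {p} → All (λ t → f (proj₂ t) ≡ g (proj₂ t)) p → E f p ≡ E g p
  E-cong-All []                       = refl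
  E-cong-All {p = (c , a) ∷ p} (e ∷ es) = cong₂ (λ u v → c ℚ.* u ℚ.+ v) e (E-cong-All es)

  δ-refl : ∀ (a : Monomial n) → δ a a ≡ 1ℚ
  δ-refl a = δ-yes {a = a} refl

  δ-≢ : ∀ (a b : Monomial n) → a ≢ b → δ a b ≡ 0ℚ
  δ-≢ a b = δ-no {a = a} {b}

  δ-sym : ∀ (a b : Monomial n) → δ a b ≡ δ b a
  δ-sym a b with a ≟ᴹ b
  ... | yes a≡b = sym (δ-yes (sym a≡b))
  ... | no  a≢b = sym (δ-no (a≢b ∘ sym))

  weighted : (Monomial n → ℚ) → List (Monomial n) → Polynomial n
  weighted f = List.map λ a → f a , a

  coefficient-weighted-∉ : ∀ f {a L} → a ∉ L → coefficient a (weighted f L) ≡ 0ℚ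
  coefficient-weighted-∉ f {L = []}    a∉ = refl
  coefficient-weighted-∉ f {L = b ∷ L} a∉ = cong₂ ℚ._+_
    (≡0⇒*≡0ʳ (f b) (δ-≢ _ _ (a∉ ∘ here)))
    (coefficient-weighted-∉ f (a∉ ∘ there))

  coefficient-weighted-∈ : ∀ f {a} {L} → Unique L → a ∈ L → coefficient a (weighted f L) ≡ f a
  coefficient-weighted-∈ f {a} {a ∷ L} (a∉ ∷ _) (here refl) = begin
    f a ℚ.* δ a a ℚ.+ coefficient a (weighted f L)
      ≡⟨ cong₂ ℚ._+_ (trans (cong (f a ℚ.*_) (δ-refl a)) (ℚₚ.*-identityʳ (f a)))
           (coefficient-weighted-∉ f {L = L} λ a∈ → All.lookup a∉ a∈ refl) ⟩
    f a ℚ.+ 0ℚ  ≡⟨ ℚₚ.+-identityʳ (f a) ⟩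
    f a         ∎
  coefficient-weighted-∈ f {a} {b ∷ L} (b∉ ∷ u) (there a∈) = begin
    f b ℚ.* δ a b ℚ.+ coefficient a (weighted f L)
      ≡⟨ cong₂ ℚ._+_ (≡0⇒*≡0ʳ (f b) (δ-≢ a b λ { refl → All.lookup b∉ a∈ refl }))
           (coefficient-weighted-∈ f u a∈) ⟩
    0ℚ ℚ.+ f a  ≡⟨ ℚₚ.+-identityˡ (f a) ⟩
    f a         ∎

  monomials : Polynomial n → List (Monomial n)
  monomials p = List.deduplicate _≟ᴹ_ (List.map proj₂ p)

  -- On the monomials of `p`, `f` is the combination of the `δ b` with `b` in `L` and weights `f b`;
  -- the two sums are then exchanged.
  E-support : ∀ f {L} → Unique L → (p : Polynomial n) → All (λ t → proj₂ t ∈ L) p →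
    E f p ≡ E (λ b → coefficient b p) (weighted f L)
  E-support f {L} u p p⊆L = begin
    E f p                                    ≡⟨ E-cong-All (All.map (λ {t} a∈ → trans
                                                  (sym (coefficient-weighted-∈ f u a∈))
                                                  (E-cong (δ-sym (proj₂ t)) (weighted f L))) p⊆L) ⟩
    E (λ a → E (λ b → δ b a) (weighted f L)) p ≡⟨ E-swap (λ a b → δ b a) p (weighted f L) ⟩
    E (λ b → coefficient b p) (weighted f L) ∎

  monomials-covers : ∀ {p : Polynomial n} {t} → t ∈ p → proj₂ t ∈ monomials p
  monomials-covers t∈p = ∈-deduplicate⁺ _≟ᴹ_ (∈-map⁺ proj₂ t∈p)

  -- A polynomial is only a formal sum, so it must be checked that a linear functional depends on
  -- the coefficients alone. Both sides are expanded over one list that covers their monomials.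
  E-resp-≈ : ∀ f {p q : Polynomial n} → p ≈ᴾ q → E f p ≡ E f q
  E-resp-≈ f {p} {q} p≈q = begin
    E f p                                    ≡⟨ E-support f u p (All.tabulate (monomials-covers ∘ ∈-++⁺ˡ)) ⟩
    E (λ b → coefficient b p) (weighted f L) ≡⟨ E-cong (_≈ᴾ_.coefficients p≈q) (weighted f L) ⟩
    E (λ b → coefficient b q) (weighted f L) ≡⟨ E-support f u q (All.tabulate (monomials-covers {p ++ q} ∘ ∈-++⁺ʳ p)) ⟨
    E f q                                    ∎
    where
    L = monomials (p ++ q)
    u = deduplicate-! _≟ᴹ_ (List.map proj₂ (p ++ q))

  coefficient-∉ : ∀ {a} (p : Polynomial n) → (∀ {t} → t ∈ p → a ≢ proj₂ t) → coefficient a p ≡ 0ℚ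
  coefficient-∉ p a∉ = trans (E-cong-All (All.tabulate (δ-≢ _ _ ∘ a∉))) (E-zero p)

  collect : ∀ (p : Polynomial n) → p ≈ᴾ weighted (λ a → coefficient a p) (monomials p)
  collect p = coefficientwise λ a → go a
    where
    open import Data.List.Membership.DecPropositional (_≟ᴹ_ {n}) using (_∈?_)
    go : ∀ a → coefficient a p ≡ coefficient a (weighted (λ a → coefficient a p) (monomials p))
    go a with a ∈? monomials p
    ... | yes a∈ = sym (coefficient-weighted-∈ _ (deduplicate-! _≟ᴹ_ (List.map proj₂ p)) a∈)
    ... | no  a∉ = trans (coefficient-∉ p λ t∈p a≡t → a∉ (subst (_∈ monomials p) (sym a≡t) (monomials-covers t∈p)))
                         (sym (coefficient-weighted-∉ _ a∉))

  E-linearCombination : ∀ {k} f (a : Monomial n → ℚ) is →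
    E f (linearCombination (Rᴹ n k) {I = Monomial n} monomial a is) ≡ E f (weighted a is)
  E-linearCombination {k} f a []       = refl
  E-linearCombination {k} f a (i ∷ is) = cong₂ ℚ._+_
    (cong₂ (λ u v → u ℚ.* f v) (ℚₚ.*-identityʳ (a i)) (·-identityˡ i)) (E-linearCombination {k} f a is)

  monomial-∣ : ∀ {a b : Monomial n} → a ⊑ b → monomial a ∣ᴾ monomial b
  monomial-∣ {a} {b} a⊑b with c , refl ← ⊑⇒∣ a⊑b =
    monomial c , CommutativeRing.reflexive (polynomialRing n) {monomial (c · a)} (cong monomial (·-comm c a))

  -- Every term of `q *ᴾ monomial a` has a monomial `c · a`. If none of these can be `b`, the
  -- coefficient of `b` is 0 there but 1 in `monomial b`.
  ∣-monomial : ∀ {a b : Monomial n} → monomial a ∣ᴾ monomial b → a ⊑ b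
  ∣-monomial {a} {b} (q , qa≈b) with divides? {n} a b
  ... | yes (c , refl) = ∣⇒⊑ a c
  ... | no ¬a∣b = contradiction (begin
    1ℚ                                     ≡⟨ cong (λ u → 1ℚ ℚ.* u ℚ.+ 0ℚ) (δ-refl b) ⟨
    coefficient b (monomial b)             ≡⟨ _≈ᴾ_.coefficients qa≈b b ⟨
    coefficient b (q *ᴾ monomial a)        ≡⟨ E-* (δ b) q (monomial a) ⟩
    E (λ c → E (λ d → δ b (c · d)) (monomial a)) q ≡⟨ E-cong (λ c →
       cong (λ u → 1ℚ ℚ.* u ℚ.+ 0ℚ) (δ-≢ _ _ λ b≡ca → ¬a∣b (c , trans (·-comm a c) (sym b≡ca)))) q ⟩
    E (λ _ → 0ℚ) q                         ≡⟨ E-zero q ⟩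
    0ℚ                                     ∎) λ ()

unit : ∀ {n} → Fin n → ℕ → Monomial n
unit zero    k = k ∷ Vec.replicate _ 0
unit (suc i) k = 0 ∷ unit i k

unit-0 : ∀ {n} (i : Fin n) → unit i 0 ≡ Vec.replicate n 0
unit-0 zero    = refl
unit-0 (suc i) = cong (0 ∷_) (unit-0 i)

unit-+ : ∀ {n} (i : Fin n) j k → unit i j · unit i k ≡ unit i (j ℕ.+ k)
unit-+ zero    j k = cong (j ℕ.+ k ∷_) (·-identityˡ _)
unit-+ (suc i) j k = cong (0 ∷_) (unit-+ i j k)

squarefree-⁅⁆ : ∀ {n} (i : Fin n) → squarefree ⁅ i ⁆ ≡ unit i 1
squarefree-⁅⁆ zero    = cong (1 ∷_) (Vecₚ.map-replicate _ outside _)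
squarefree-⁅⁆ (suc i) = cong (0 ∷_) (squarefree-⁅⁆ i)

x^ : ∀ {n} (i : Fin n) k → x i ^ᴾ k ≡ monomial (unit i k)
x^ i zero    = cong monomial (sym (unit-0 i))
x^ i (suc k) = trans (cong₂ _*ᴾ_ (cong monomial (squarefree-⁅⁆ i)) (x^ i k)) (cong monomial (unit-+ i 1 k))

unit-⊑ : ∀ {n} (i : Fin n) {k} {a : Monomial n} → k ≤ lookup a i → unit i k ⊑ a
unit-⊑ zero    {a = _ ∷ a} k≤ = k≤ ∷ zeros-⊑ a
  where
  zeros-⊑ : ∀ {n} (a : Monomial n) → Vec.replicate n 0 ⊑ a
  zeros-⊑ []      = []
  zeros-⊑ (x ∷ a) = z≤n ∷ zeros-⊑ a
unit-⊑ (suc i) {a = _ ∷ a} k≤ = z≤n ∷ unit-⊑ i k≤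

⊑-unit : ∀ {n} (i : Fin n) {k} {a : Monomial n} → unit i k ⊑ a → k ≤ lookup a i
⊑-unit zero    (h ∷ _) = h
⊑-unit (suc i) (_ ∷ p) = ⊑-unit i p

insertAt-unit : ∀ {n} (p : Fin (suc n)) (i : Fin n) k → insertAt (unit i k) p 0 ≡ unit (punchIn p i) k
insertAt-unit zero    i       k = refl
insertAt-unit (suc p) zero    k = cong (k ∷_) (go p)
  where
  go : ∀ {n} (p : Fin (suc n)) → insertAt (Vec.replicate n 0) p 0 ≡ Vec.replicate (suc n) 0
  go zero = refl
  go {suc n} (suc p) = cong (0 ∷_) (go p)
insertAt-unit (suc p) (suc i) k = cong (0 ∷_) (insertAt-unit p i k)

insertAt-· : ∀ {n} (a b : Monomial n) p i j → insertAt a p i · insertAt b p j ≡ insertAt (a · b) p (i ℕ.+ j)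
insertAt-· a       b       zero    i j = refl
insertAt-· (x ∷ a) (y ∷ b) (suc p) i j = cong (x ℕ.+ y ∷_) (insertAt-· a b p i j)

e : ∀ n → ℕ → Polynomial n
e = elementarySymmetric

private
  filter-inside : ∀ {n} d (xs : List (Subset n)) →
    List.filter (λ S → ∣ S ∣ ℕₚ.≟ suc d) (List.map (inside ∷_) xs) ≡
    List.map (inside ∷_) (List.filter (λ S → ∣ S ∣ ℕₚ.≟ d) xs)
  filter-inside d []       = refl
  filter-inside d (S ∷ xs) with ∣ S ∣ ℕ.≡ᵇ d
  ... | true  = cong (_ ∷_) (filter-inside d xs)
  ... | false = filter-inside d xs

  filter-inside-0 : ∀ {n} (xs : List (Subset n)) →
    List.filter (λ S → ∣ S ∣ ℕₚ.≟ 0) (List.map (inside ∷_) xs) ≡ []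
  filter-inside-0 []       = refl
  filter-inside-0 (S ∷ xs) = filter-inside-0 xs

  filter-outside : ∀ {n} d (xs : List (Subset n)) →
    List.filter (λ S → ∣ S ∣ ℕₚ.≟ d) (List.map (outside ∷_) xs) ≡
    List.map (outside ∷_) (List.filter (λ S → ∣ S ∣ ℕₚ.≟ d) xs)
  filter-outside d []       = refl
  filter-outside d (S ∷ xs) with ∣ S ∣ ℕ.≡ᵇ d
  ... | true  = cong (_ ∷_) (filter-outside d xs)
  ... | false = filter-outside d xs

-- e⁻ n d is e n (d - 1), which is 0 for d = 0.
e⁻ : ∀ n → ℕ → Polynomial n
e⁻ n zero    = []
e⁻ n (suc d) = e n d

-- Reads a polynomial in the variables other than `x p` and multiplies it by the `j`-th power of
-- `x p`.
insertVariable : ∀ {n} → Fin (suc n) → ℕ → Polynomial n → Polynomial (suc n)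
insertVariable p j = List.map (map₂ λ a → insertAt a p j)

E-insertVariable : ∀ {n} f p j (q : Polynomial n) →
  E f (insertVariable p j q) ≡ E (λ a → f (insertAt a p j)) q
E-insertVariable f p j []            = refl
E-insertVariable f p j ((c , a) ∷ q) = cong (c ℚ.* f (insertAt a p j) ℚ.+_) (E-insertVariable f p j q)

e-suc : ∀ n d → e (suc n) d ≡ insertVariable zero 1 (e⁻ n d) ++ insertVariable zero 0 (e n d)
e-suc n d = begin
  List.map term (size d (List.map (inside ∷_) (subsets n) ++ List.map (outside ∷_) (subsets n)))
    ≡⟨ cong (List.map term) (Listₚ.filter-++ (λ S → ∣ S ∣ ℕₚ.≟ d) (List.map (inside ∷_) (subsets n)) _) ⟩
  List.map term (size d (List.map (inside ∷_) (subsets n)) ++ size d (List.map (outside ∷_) (subsets n)))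
    ≡⟨ Listₚ.map-++ term (size d (List.map (inside ∷_) (subsets n))) _ ⟩
  List.map term (size d (List.map (inside ∷_) (subsets n))) ++
  List.map term (size d (List.map (outside ∷_) (subsets n)))
    ≡⟨ cong₂ _++_ (with-first d) (trans (cong (List.map term) (filter-outside d (subsets n)))
                                        (map-cons outside (size d (subsets n)))) ⟩
  insertVariable zero 1 (e⁻ n d) ++ insertVariable zero 0 (e n d) ∎
  where
  term : ∀ {n} → Subset n → ℚ × Monomial n
  term S = 1ℚ , squarefree S

  size : ∀ {n} → ℕ → List (Subset n) → List (Subset n)
  size d = List.filter λ S → ∣ S ∣ ℕₚ.≟ d

  map-cons : ∀ {n} b (xs : List (Subset n)) →
    List.map term (List.map (b ∷_) xs) ≡ insertVariable zero (if b then 1 else 0) (List.map term xs)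
  map-cons b xs = trans (sym (Listₚ.map-∘ xs)) (Listₚ.map-∘ xs)

  with-first : ∀ d → List.map term (size d (List.map (inside ∷_) (subsets n))) ≡ insertVariable zero 1 (e⁻ n d)
  with-first zero    = cong (List.map term) (filter-inside-0 (subsets n))
  with-first (suc d) = trans (cong (List.map term) (filter-inside d (subsets n))) (map-cons inside (size d (subsets n)))

private
  E-e-suc : ∀ {n} (f : Monomial (suc n) → ℚ) d →
    E f (e (suc n) d) ≡ E (f ∘ (1 ∷_)) (e⁻ n d) ℚ.+ E (f ∘ (0 ∷_)) (e n d)
  E-e-suc {n} f d = begin
    E f (e (suc n) d) ≡⟨ cong (E f) (e-suc n d) ⟩
    E f (insertVariable zero 1 (e⁻ n d) ++ insertVariable zero 0 (e n d)) ≡⟨ E-+ f (insertVariable zero 1 (e⁻ n d)) _ ⟩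
    _ ≡⟨ cong₂ ℚ._+_ (E-insertVariable f zero 1 (e⁻ n d)) (E-insertVariable f zero 0 (e n d)) ⟩
    E (f ∘ (1 ∷_)) (e⁻ n d) ℚ.+ E (f ∘ (0 ∷_)) (e n d) ∎

  E-e⁻-suc : ∀ {n} (f : Monomial (suc n) → ℚ) d →
    E f (e⁻ (suc n) d) ≡ E (f ∘ (1 ∷_)) (e⁻ n (d ∸ 1)) ℚ.+ E (f ∘ (0 ∷_)) (e⁻ n d)
  -- The truncated `d ∸ 1` does no harm here: `e⁻` at 0 is empty on both sides.
  E-e⁻-suc f zero    = refl
  E-e⁻-suc f (suc d) = E-e-suc f d

-- The symmetry of e_d, in the form that any variable can be split off. Splitting off the first
-- variable as well gives four terms on either side, which agree once the two middle ones are
-- exchanged.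
E-e-insertAt : ∀ {n} (f : Monomial (suc n) → ℚ) p d → E f (e (suc n) d) ≡
  E (λ b → f (insertAt b p 1)) (e⁻ n d) ℚ.+ E (λ b → f (insertAt b p 0)) (e n d)
E-e-insertAt {n}     f zero    d = E-e-suc f d
E-e-insertAt {suc n} f (suc p) d = begin
  E f (e (suc (suc n)) d)
    ≡⟨ E-e-suc f d ⟩
  E (f ∘ (1 ∷_)) (e⁻ (suc n) d) ℚ.+ E (f ∘ (0 ∷_)) (e (suc n) d)
    ≡⟨ cong₂ ℚ._+_ (E-e⁻-insertAt d) (E-e-insertAt (f ∘ (0 ∷_)) p d) ⟩
  (E (g 1 1) (e⁻ n (d ∸ 1)) ℚ.+ E (g 1 0) (e⁻ n d)) ℚ.+ (E (g 0 1) (e⁻ n d) ℚ.+ E (g 0 0) (e n d))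
    ≡⟨ interchange (E (g 1 1) (e⁻ n (d ∸ 1))) _ _ _ ⟩
  (E (g 1 1) (e⁻ n (d ∸ 1)) ℚ.+ E (g 0 1) (e⁻ n d)) ℚ.+ (E (g 1 0) (e⁻ n d) ℚ.+ E (g 0 0) (e n d))
    ≡⟨ cong₂ ℚ._+_ (E-e⁻-suc (λ b → f (insertAt b (suc p) 1)) d) (E-e-suc (λ b → f (insertAt b (suc p) 0)) d) ⟨
  E (λ b → f (insertAt b (suc p) 1)) (e⁻ (suc n) d) ℚ.+ E (λ b → f (insertAt b (suc p) 0)) (e (suc n) d) ∎
  where
  open CommutativeSemigroupProperties (CommutativeRing.+-commutativeSemigroup ℚₚ.+-*-commutativeRing) using (interchange)
  g : ℕ → ℕ → Monomial n → ℚ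
  g i j b = f (i ∷ insertAt b p j)

  E-e⁻-insertAt : ∀ d → E (f ∘ (1 ∷_)) (e⁻ (suc n) d) ≡ E (g 1 1) (e⁻ n (d ∸ 1)) ℚ.+ E (g 1 0) (e⁻ n d)
  E-e⁻-insertAt zero    = refl
  E-e⁻-insertAt (suc d) = E-e-insertAt (f ∘ (1 ∷_)) p d

e-insertVariable : ∀ {n} p d → e (suc n) d ≈ᴾ insertVariable p 1 (e⁻ n d) +ᴾ insertVariable p 0 (e n d)
e-insertVariable {n} p d = coefficientwise λ a → begin
  E (δ a) (e (suc n) d) ≡⟨ E-e-insertAt (δ a) p d ⟩
  _ ≡⟨ cong₂ ℚ._+_ (E-insertVariable (δ a) p 1 (e⁻ n d)) (E-insertVariable (δ a) p 0 (e n d)) ⟨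
  E (δ a) (insertVariable p 1 (e⁻ n d)) ℚ.+ E (δ a) (insertVariable p 0 (e n d))
    ≡⟨ E-+ (δ a) (insertVariable p 1 (e⁻ n d)) _ ⟨
  E (δ a) (insertVariable p 1 (e⁻ n d) +ᴾ insertVariable p 0 (e n d)) ∎

E-e-zero : ∀ {n} f d → (∀ S → ∣ S ∣ ≡ d → f (squarefree S) ≡ 0ℚ) → E f (e n d) ≡ 0ℚ
E-e-zero {n} f d f≡0 = go (subsets n)
  where
  go : ∀ xs → E f (List.map (λ S → 1ℚ , squarefree S) (List.filter (λ S → ∣ S ∣ ℕₚ.≟ d) xs)) ≡ 0ℚ
  go []       = refl
  go (S ∷ xs) with ∣ S ∣ ℕ.≡ᵇ d in eq
  ... | true  = cong₂ (λ u v → 1ℚ ℚ.* u ℚ.+ v) (f≡0 S (ℕₚ.≡ᵇ⇒≡ ∣ S ∣ d (subst T (sym eq) _))) (go xs)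
  ... | false = go xs

-- Linear independence

module _ {a} {A : Set a} where

  swapAt : ∀ {n} → Fin n → Vec A (suc n) → Vec A (suc n)
  swapAt zero    (x ∷ y ∷ v) = y ∷ x ∷ v
  swapAt (suc i) (x ∷ v)     = x ∷ swapAt i v

swapAt-· : ∀ {n} (i : Fin n) (a b : Monomial (suc n)) → swapAt i a · swapAt i b ≡ swapAt i (a · b)
swapAt-· zero    (_ ∷ _ ∷ _) (_ ∷ _ ∷ _) = refl
swapAt-· (suc i) (_ ∷ a)     (_ ∷ b)     = cong (_ ∷_) (swapAt-· i a b)

-- Exchanging the first two variables turns an insertion at position 0 into one at position 1, and
-- e_d expands in the same way along both.
E-e-swapAt : ∀ {n} (i : Fin n) (f : Monomial (suc n) → ℚ) d →
  E (f ∘ swapAt i) (e (suc n) d) ≡ E f (e (suc n) d)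
E-e-swapAt {suc n} zero f d = begin
  E (f ∘ swapAt zero) (e (suc (suc n)) d)
    ≡⟨ E-e-insertAt (f ∘ swapAt zero) zero d ⟩
  E (λ b → f (swapAt zero (1 ∷ b))) (e⁻ (suc n) d) ℚ.+ E (λ b → f (swapAt zero (0 ∷ b))) (e (suc n) d)
    ≡⟨ cong₂ ℚ._+_ (E-cong (λ b → cong f (lemma b 1)) (e⁻ (suc n) d)) (E-cong (λ b → cong f (lemma b 0)) (e (suc n) d)) ⟩
  E (λ b → f (insertAt b (suc zero) 1)) (e⁻ (suc n) d) ℚ.+ E (λ b → f (insertAt b (suc zero) 0)) (e (suc n) d)
    ≡⟨ E-e-insertAt f (suc zero) d ⟨
  E f (e (suc (suc n)) d) ∎
  where
  lemma : ∀ (b : Monomial (suc n)) j → swapAt zero (j ∷ b) ≡ insertAt b (suc zero) j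
  lemma (x ∷ b) j = refl
E-e-swapAt {suc n} (suc i) f d = begin
  E (f ∘ swapAt (suc i)) (e (suc (suc n)) d)
    ≡⟨ E-e-insertAt (f ∘ swapAt (suc i)) zero d ⟩
  E (f ∘ (1 ∷_) ∘ swapAt i) (e⁻ (suc n) d) ℚ.+ E (f ∘ (0 ∷_) ∘ swapAt i) (e (suc n) d)
    ≡⟨ cong₂ ℚ._+_ (E-e⁻-swapAt d) (E-e-swapAt i (f ∘ (0 ∷_)) d) ⟩
  E (f ∘ (1 ∷_)) (e⁻ (suc n) d) ℚ.+ E (f ∘ (0 ∷_)) (e (suc n) d)
    ≡⟨ E-e-insertAt f zero d ⟨
  E f (e (suc (suc n)) d) ∎
  where
  E-e⁻-swapAt : ∀ d → E (f ∘ (1 ∷_) ∘ swapAt i) (e⁻ (suc n) d) ≡ E (f ∘ (1 ∷_)) (e⁻ (suc n) d)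
  E-e⁻-swapAt zero    = refl
  E-e⁻-swapAt (suc d) = E-e-swapAt i (f ∘ (1 ∷_)) d

-- Alternating functions and the Vandermonde determinant

Alternating : ∀ {n} → (Vec ℕ (suc n) → ℚ) → Set
Alternating F = ∀ i v → F (swapAt i v) ≡ ℚ.- F v

≡-⇒≡0 : ∀ {q} → q ≡ ℚ.- q → q ≡ 0ℚ
≡-⇒≡0 {q} q≡-q = begin
  q                    ≡⟨ solve 1 (λ q → q := con ½ :* (q :+ q)) refl q ⟩
  ½ ℚ.* (q ℚ.+ q)      ≡⟨ cong (λ r → ½ ℚ.* (q ℚ.+ r)) q≡-q ⟩
  ½ ℚ.* (q ℚ.+ ℚ.- q)  ≡⟨ solve 1 (λ q → con ½ :* (q :+ :- q) := con 0ℚ) refl q ⟩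
  0ℚ                   ∎
  where open +-*-Solver

-- Adjacent transpositions, which only change the sign, carry `x` next to the entry equal to it.
-- Exchanging two equal neighbours then gives F = -F.
alternating-∈ : ∀ {n} {F : Vec ℕ (suc n) → ℚ} → Alternating F → ∀ {x v} → x ∈ᵛ v → F (x ∷ v) ≡ 0ℚ
alternating-∈ alternating (here refl) = ≡-⇒≡0 (alternating zero _)
alternating-∈ {F = F} alternating {x} {y ∷ v} (there x∈v) = begin
  F (x ∷ y ∷ v)      ≡⟨ alternating zero (y ∷ x ∷ v) ⟩
  ℚ.- F (y ∷ x ∷ v)  ≡⟨ cong ℚ.-_ (alternating-∈ {F = F ∘ (y ∷_)} (λ i w → alternating (suc i) (y ∷ w)) x∈v) ⟩
  0ℚ                 ∎

∉⇒All≢ : ∀ {n x} {v : Vec ℕ n} → ¬ (x ∈ᵛ v) → Allᵛ (x ≢_) v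
∉⇒All≢ {v = []}    x∉v = []
∉⇒All≢ {v = y ∷ v} x∉v = x∉v ∘ here ∷ ∉⇒All≢ (x∉v ∘ there)

alternating-unique : ∀ {n} {F : Vec ℕ (suc n) → ℚ} → Alternating F → ∀ v → Uniqueᵛ v ⊎ F v ≡ 0ℚ
alternating-unique alternating (x ∷ []) = inj₁ ([] ∷ [])
alternating-unique {F = F} alternating (x ∷ v@(_ ∷ _))
  with alternating-unique {F = F ∘ (x ∷_)} (λ i w → alternating (suc i) (x ∷ w)) v | Anyᵛ.any? (x ℕₚ.≟_) v
... | inj₂ F≡0 | _       = inj₂ F≡0
... | inj₁ u   | yes x∈v = inj₂ (alternating-∈ {F = F} alternating x∈v)
... | inj₁ u   | no  x∉v = inj₁ (∉⇒All≢ x∉v ∷ u)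

below : ℕ → ℕ → ℚ
below N x = if does (x ℕₚ.<? N) then 1ℚ else 0ℚ

below-< : ∀ {N x} → x < N → below N x ≡ 1ℚ
below-< {N} {x} x<N = cong (λ b → if b then 1ℚ else 0ℚ) (dec-true (x ℕₚ.<? N) x<N)

below-≮ : ∀ {N x} → ¬ x < N → below N x ≡ 0ℚ
below-≮ {N} {x} x≮N = cong (λ b → if b then 1ℚ else 0ℚ) (dec-false (x ℕₚ.<? N) x≮N)

order : ℕ → ℕ → ℚ
order x y with ℕₚ.<-cmp x y
... | tri< _ _ _ = 1ℚ
... | tri≈ _ _ _ = 0ℚ
... | tri> _ _ _ = ℚ.- 1ℚ

order-antisym : ∀ x y → order y x ≡ ℚ.- order x y
order-antisym x y with ℕₚ.<-cmp x y | ℕₚ.<-cmp y x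
... | tri< _ _ _   | tri> _ _ _   = refl
... | tri≈ _ _ _   | tri≈ _ _ _   = refl
... | tri> _ _ _   | tri< _ _ _   = refl
... | tri< x<y _ _ | tri< y<x _ _ = contradiction x<y (ℕₚ.<-asym y<x)
... | tri< x<y _ _ | tri≈ _ refl _ = contradiction x<y (ℕₚ.<-irrefl refl)
... | tri≈ _ refl _ | tri< y<x _ _ = contradiction y<x (ℕₚ.<-irrefl refl)
... | tri≈ _ refl _ | tri> _ _ y>x = contradiction y>x (ℕₚ.<-irrefl refl)
... | tri> _ _ x>y | tri≈ _ refl _ = contradiction x>y (ℕₚ.<-irrefl refl)
... | tri> _ _ x>y | tri> _ _ y>x = contradiction x>y (ℕₚ.<-asym y>x)

order-refl : ∀ x → order x x ≡ 0ℚ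
order-refl x = ≡-⇒≡0 (order-antisym x x)

order-< : ∀ {x y} → x < y → order x y ≡ 1ℚ
order-< {x} {y} x<y with ℕₚ.<-cmp x y
... | tri< _ _ _   = refl
... | tri≈ x≮y _ _ = contradiction x<y x≮y
... | tri> x≮y _ _ = contradiction x<y x≮y

-- The sign contributed by the pairs that `x` forms with later entries.
cross : ∀ {n} → ℕ → Vec ℕ n → ℚ
cross x []      = 1ℚ
cross x (y ∷ v) = order x y ℚ.* cross x v

-- The sign of v as a permutation of 0, …, N - 1, when v has length N, and 0
-- if it is not one: the coefficient of y^v in the Vandermonde determinant.
alt : ∀ {n} → ℕ → Vec ℕ n → ℚ
alt N []      = 1ℚ
alt N (x ∷ v) = below N x ℚ.* (cross x v ℚ.* alt N v)

cross-swapAt : ∀ {n} x (i : Fin n) v → cross x (swapAt i v) ≡ cross x v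
cross-swapAt x zero    (y ∷ z ∷ v) =
  solve 3 (λ a b c → b :* (a :* c) := a :* (b :* c)) refl (order x y) (order x z) (cross x v)
  where open +-*-Solver
cross-swapAt x (suc i) (y ∷ v)     = cong (order x y ℚ.*_) (cross-swapAt x i v)

-- Exchanging the first two entries flips the factor `order x y` and merely rearranges the others.
alt-alternating : ∀ {n} N → Alternating (alt {suc n} N)
alt-alternating N zero    (x ∷ y ∷ v) = begin
  below N y ℚ.* ((order y x ℚ.* cross y v) ℚ.* (below N x ℚ.* (cross x v ℚ.* alt N v)))
    ≡⟨ cong (λ o → below N y ℚ.* ((o ℚ.* cross y v) ℚ.* (below N x ℚ.* (cross x v ℚ.* alt N v)))) (order-antisym x y) ⟩
  below N y ℚ.* ((ℚ.- order x y ℚ.* cross y v) ℚ.* (below N x ℚ.* (cross x v ℚ.* alt N v)))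
    ≡⟨ solve 6 (λ bx by o cx cy a → by :* ((:- o :* cy) :* (bx :* (cx :* a))) :=
                                    :- (bx :* ((o :* cx) :* (by :* (cy :* a))))) refl
         (below N x) (below N y) (order x y) (cross x v) (cross y v) (alt N v) ⟩
  ℚ.- (below N x ℚ.* ((order x y ℚ.* cross x v) ℚ.* (below N y ℚ.* (cross y v ℚ.* alt N v)))) ∎
  where open +-*-Solver
alt-alternating {suc n} N (suc i) (x ∷ v)     = begin
  below N x ℚ.* (cross x (swapAt i v) ℚ.* alt N (swapAt i v))
    ≡⟨ cong₂ (λ c a → below N x ℚ.* (c ℚ.* a)) (cross-swapAt x i v) (alt-alternating N i v) ⟩
  below N x ℚ.* (cross x v ℚ.* ℚ.- alt N v)
    ≡⟨ solve 3 (λ b c a → b :* (c :* :- a) := :- (b :* (c :* a))) refl (below N x) (cross x v) (alt N v) ⟩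
  ℚ.- (below N x ℚ.* (cross x v ℚ.* alt N v)) ∎
  where open +-*-Solver

cross-∈ : ∀ {n x} {v : Vec ℕ n} → x ∈ᵛ v → cross x v ≡ 0ℚ
cross-∈ {x = x}         (here refl) = ≡0⇒*≡0 (order-refl x)
cross-∈ {x = x} {y ∷ v} (there x∈v) = ≡0⇒*≡0ʳ (order x y) (cross-∈ x∈v)

IsPermutation : ∀ {n} → ℕ → Vec ℕ n → Set
IsPermutation N v = Uniqueᵛ v × Allᵛ (_< N) v

alt-support : ∀ {n} N (v : Vec ℕ n) → alt N v ≡ 0ℚ ⊎ IsPermutation N v
alt-support N []      = inj₂ ([] , [])
alt-support N (x ∷ v) with x ℕₚ.<? N | Anyᵛ.any? (x ℕₚ.≟_) v | alt-support N v
... | no x≮N  | _       | _              = inj₁ (≡0⇒*≡0 (below-≮ x≮N))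
... | yes _   | yes x∈v | _              = inj₁ (≡0⇒*≡0ʳ (below N x) (≡0⇒*≡0 (cross-∈ x∈v)))
... | yes _   | no _    | inj₁ alt≡0     = inj₁ (≡0⇒*≡0ʳ (below N x) (≡0⇒*≡0ʳ (cross x v) alt≡0))
... | yes x<N | no x∉v  | inj₂ (u , v<N) = inj₂ (∉⇒All≢ x∉v ∷ u , x<N ∷ v<N)

permutation-surjective : ∀ {N} {v : Vec ℕ N} → IsPermutation N v → ∀ {c} → c < N → ∃ λ p → lookup v p ≡ c
permutation-surjective {suc N} {v} (u , v<N) {c} c<N with Finₚ.any? (λ p → lookup v p ℕₚ.≟ c)
... | yes found = found
-- Pigeonhole: if the value `c` is missed, removing it by `punchOut` makes the entries an injection
-- from `Fin (suc N)` to `Fin N`.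
... | no  c∉v   = contradiction (Finₚ.injective⇒≤ f-injective) ℕₚ.1+n≰n
  where
  value : Fin (suc N) → Fin (suc N)
  value p = fromℕ< (Allᵛₚ.lookup⁺ v<N p)

  c≢value : ∀ p → fromℕ< c<N ≢ value p
  c≢value p c≡ = c∉v (p , sym (Finₚ.fromℕ<-injective _ _ c<N (Allᵛₚ.lookup⁺ v<N p) c≡))

  f : Fin (suc N) → Fin N
  f p = punchOut (c≢value p)

  f-injective : ∀ {p q} → f p ≡ f q → p ≡ q
  f-injective {p} {q} fp≡fq = lookup-injective u p q
    (Finₚ.fromℕ<-injective _ _ _ _ (Finₚ.punchOut-injective (c≢value p) (c≢value q) fp≡fq))

-- Raising some entries of a permutation by 1 does not give another one: by
-- induction on c, the entry with the value c in m · S has not been raised,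
-- for otherwise it meets in m the entry with the value c - 1.
permutation-lift : ∀ {N} (m : Vec ℕ N) (S : Subset N) → Uniqueᵛ m →
  IsPermutation N (m · squarefree S) → ∣ S ∣ ≡ 0
permutation-lift {N} m S m! perm@(_ , mS<N) = count-0 S λ p → unraised _ p refl
  where
  unraised : ∀ c p → lookup (m · squarefree S) p ≡ c → lookup S p ≡ outside
  unraised = <-rec _ go
    where
    value : ∀ p → lookup (m · squarefree S) p ≡ lookup m p ℕ.+ (if lookup S p then 1 else 0)
    value p = trans (Vecₚ.lookup-zipWith ℕ._+_ p m (squarefree S)) (cong (lookup m p ℕ.+_) (Vecₚ.lookup-map p _ S))

    go : ∀ c → (∀ {c′} → c′ < c → ∀ q → lookup (m · squarefree S) q ≡ c′ → lookup S q ≡ outside) →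
         ∀ p → lookup (m · squarefree S) p ≡ c → lookup S p ≡ outside
    go c IH p mS≡c with lookup S p in eq
    ... | outside = refl
    ... | inside  = trans (sym eq) (subst (λ q → lookup S q ≡ outside) (lookup-injective m! q p m≡m) q∉S)
      where
      m<mS : lookup m p < lookup (m · squarefree S) p
      m<mS = ℕₚ.≤-reflexive (sym (trans (value p)
        (trans (cong (λ b → lookup m p ℕ.+ (if b then 1 else 0)) eq) (ℕₚ.+-comm (lookup m p) 1))))

      attained : ∃ λ q → lookup (m · squarefree S) q ≡ lookup m p
      attained = permutation-surjective perm (ℕₚ.<-trans m<mS (Allᵛₚ.lookup⁺ mS<N p))

      q = proj₁ attained

      q∉S : lookup S q ≡ outside
      q∉S = IH (subst (lookup m p <_) mS≡c m<mS) q (proj₂ attained)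

      m≡m : lookup m q ≡ lookup m p
      m≡m = begin
        lookup m q ≡⟨ ℕₚ.+-identityʳ _ ⟨
        lookup m q ℕ.+ 0 ≡⟨ cong (λ b → lookup m q ℕ.+ (if b then 1 else 0)) q∉S ⟨
        lookup m q ℕ.+ (if lookup S q then 1 else 0) ≡⟨ value q ⟨
        lookup (m · squarefree S) q ≡⟨ proj₂ attained ⟩
        lookup m p ∎

  count-0 : ∀ {n} (S : Subset n) → (∀ p → lookup S p ≡ outside) → ∣ S ∣ ≡ 0
  count-0 []            _   = refl
  count-0 (inside  ∷ S) out with () ← out zero
  count-0 (outside ∷ S) out = count-0 S (out ∘ suc)

-- Since e_d is symmetric, the pairing is alternating in `m`, hence 0 unless the entries of `m` are
-- distinct. In that case every term is already 0: by `permutation-lift`, raising `d ≥ 1` distinct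
-- entries cannot produce a permutation.
alt-elementary : ∀ n m d → 1 ≤ d → E (λ b → alt n (m · b)) (e n d) ≡ 0ℚ
alt-elementary zero    m (suc d) _ = refl
alt-elementary (suc n) m d 1≤d = case alternating-unique {F = F} F-alternating m of λ where
    (inj₂ F≡0) → F≡0
    (inj₁ m!)  → E-e-zero (λ b → alt (suc n) (m · b)) d λ S ∣S∣≡d →
      case alt-support (suc n) (m · squarefree S) of λ where
        (inj₁ alt≡0) → alt≡0
        (inj₂ perm)  → contradiction (trans (sym ∣S∣≡d) (permutation-lift m S m! perm)) (ℕₚ.>⇒≢ 1≤d)
  where
  F : Monomial (suc n) → ℚ
  F m = E (λ b → alt (suc n) (m · b)) (e (suc n) d)

  F-alternating : Alternating F
  F-alternating i m = begin
    E (λ b → alt (suc n) (swapAt i m · b)) (e (suc n) d)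
      ≡⟨ E-e-swapAt i (λ b → alt (suc n) (swapAt i m · b)) d ⟨
    E (λ b → alt (suc n) (swapAt i m · swapAt i b)) (e (suc n) d)
      ≡⟨ E-cong (λ b → trans (cong (alt (suc n)) (swapAt-· i m b)) (trans (alt-alternating (suc n) i (m · b))
           (sym (-1*x≈-x _)))) (e (suc n) d) ⟩
    E (λ b → ℚ.- 1ℚ ℚ.* alt (suc n) (m · b)) (e (suc n) d)
      ≡⟨ E-scale (ℚ.- 1ℚ) (λ b → alt (suc n) (m · b)) (e (suc n) d) ⟩
    ℚ.- 1ℚ ℚ.* F m
      ≡⟨ -1*x≈-x (F m) ⟩
    ℚ.- F m ∎

-- The monomial order

infix 4 _≺_ _≼_

data _≺_ : ∀ {n} → Monomial n → Monomial n → Set where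
  here  : ∀ {n x y} {v : Monomial n} → x < y → (x ∷ v) ≺ (y ∷ v)
  there : ∀ {n x y} {v w : Monomial n} → v ≺ w → (x ∷ v) ≺ (y ∷ w)

_≼_ : ∀ {n} → Monomial n → Monomial n → Set
v ≼ w = v ≡ w ⊎ v ≺ w

-- Nested induction, on the tail outside and on the head inside: when the tail decreases, the head
-- may become arbitrary and its accessibility starts afresh.
≺-wellFounded : ∀ {n} → WellFounded (_≺_ {n})
≺-wellFounded []      = acc λ ()
≺-wellFounded (x ∷ v) = acc (step (≺-wellFounded v) (<-wellFounded x))
  where
  step : ∀ {n x} {v : Monomial n} {w} → Acc _≺_ v → Acc _<_ x → w ≺ (x ∷ v) → Acc _≺_ w
  step av       (acc rx) (here y<x)  = acc (step av (rx y<x))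
  step (acc rv) _        (there w≺v) = acc (step (rv w≺v) (<-wellFounded _))

insertAt-mono-≺ : ∀ {n} {v w : Monomial n} p j → v ≺ w → insertAt v p j ≺ insertAt w p j
insertAt-mono-≺ zero    j v≺w         = there v≺w
insertAt-mono-≺ (suc p) j (here x<y)  = here x<y
insertAt-mono-≺ (suc p) j (there v≺w) = there (insertAt-mono-≺ p j v≺w)

insertAt-mono-≼ : ∀ {n} {v w : Monomial n} p j → v ≼ w → insertAt v p j ≼ insertAt w p j
insertAt-mono-≼ p j (inj₁ refl) = inj₁ refl
insertAt-mono-≼ p j (inj₂ v≺w)  = inj₂ (insertAt-mono-≺ p j v≺w)

·-cancelʳ : ∀ {n} (v w c : Monomial n) → v · c ≡ w · c → v ≡ w
·-cancelʳ v w c eq = ·-cancelˡ {0} c v w (trans (·-comm c v) (trans eq (·-comm w c)))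

·-cancelʳ-≺ : ∀ {n} (v w c : Monomial n) → (v · c) ≺ (w · c) → v ≺ w
·-cancelʳ-≺ v w c vc≺wc = go v w c refl refl vc≺wc
  where
  -- The products are named `v′` and `w′` so that the proof of `v′ ≺ w′` can be matched.
  go : ∀ {n} (v w c : Monomial n) {v′ w′} → v · c ≡ v′ → w · c ≡ w′ → v′ ≺ w′ → v ≺ w
  go (x ∷ v) (y ∷ w) (z ∷ c) refl wc≡ (here x<y) with refl ← ·-cancelʳ w v c (Vecₚ.∷-injectiveʳ wc≡) =
    here (ℕₚ.+-cancelʳ-< z x y (subst (x ℕ.+ z <_) (sym (Vecₚ.∷-injectiveˡ wc≡)) x<y))
  go (x ∷ v) (y ∷ w) (z ∷ c) refl refl (there lt) = there (go v w c refl refl lt)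

·-cancelʳ-≼ : ∀ {n} (v w c : Monomial n) → (v · c) ≼ (w · c) → v ≼ w
·-cancelʳ-≼ v w c (inj₁ eq) = inj₁ (·-cancelʳ v w c eq)
·-cancelʳ-≼ v w c (inj₂ lt) = inj₂ (·-cancelʳ-≺ v w c lt)

staircaseᵛ : ∀ r n → Monomial n
staircaseᵛ = Vec.iterate suc

∈-staircaseᵛ : ∀ {x r} n → r ≤ x → x < r ℕ.+ n → x ∈ᵛ staircaseᵛ r n
∈-staircaseᵛ {x} {r} zero    r≤x x<r+n = contradiction r≤x (ℕₚ.<⇒≱ (subst (x <_) (ℕₚ.+-identityʳ r) x<r+n))
∈-staircaseᵛ {x} {r} (suc n) r≤x x<r+n with x ℕₚ.≟ r
... | yes x≡r = here x≡r
... | no  x≢r = there (∈-staircaseᵛ n (ℕₚ.≤∧≢⇒< r≤x (x≢r ∘ sym)) (subst (x <_) (ℕₚ.+-suc r n) x<r+n))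

-- The tail decides unless it is exactly r + 1, ..., N - 1. The head is less than `N` and differs
-- from all of these, so it is at most `r`.
permutation-≼ : ∀ {n N r} → N ≡ r ℕ.+ n → (v : Monomial n) → IsPermutation N v → v ≼ staircaseᵛ r n
permutation-≼ N≡ []      _ = inj₁ refl
permutation-≼ {suc n} {r = r} N≡ (x ∷ v) (x∉v ∷ v! , x<N ∷ v<N)
  with permutation-≼ {r = suc r} (trans N≡ (ℕₚ.+-suc r n)) v (v! , v<N)
... | inj₂ v≺ = inj₂ (there v≺)
... | inj₁ refl with ℕₚ.<-cmp x r
...   | tri< x<r _ _  = inj₂ (here x<r)
...   | tri≈ _ refl _ = inj₁ refl
...   | tri> _ _ r<x  =
  contradiction refl (Allᵛ.lookup x∉v (∈-staircaseᵛ n r<x (subst (x <_) (trans N≡ (ℕₚ.+-suc r n)) x<N)))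

alt-staircaseᵛ : ∀ {n N r} → N ≡ r ℕ.+ n → alt N (staircaseᵛ r n) ≡ 1ℚ
alt-staircaseᵛ {zero}          N≡ = refl
alt-staircaseᵛ {suc n} {N} {r} N≡ = cong₂ ℚ._*_ (below-< (subst (r <_) (sym N≡) (ℕₚ.m<m+n r ℕ.z<s)))
  (cong₂ ℚ._*_ (cross≡1 n ℕₚ.≤-refl) (alt-staircaseᵛ {r = suc r} (trans N≡ (ℕₚ.+-suc r n))))
  where
  cross≡1 : ∀ {r r′} n → r < r′ → cross r (staircaseᵛ r′ n) ≡ 1ℚ
  cross≡1 zero    r<r′ = refl
  cross≡1 (suc n) r<r′ = cong₂ ℚ._*_ (order-< r<r′) (cross≡1 n (ℕₚ.m≤n⇒m≤1+n r<r′))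

-- Dual functionals

module _ {n : ℕ} (k : ℕ) where

  -- The linear extension of `f` kills I_{n,k,s}: the fields test it on the monomial multiples of
  -- the generators. The bound d > n - s is written without subtraction.
  record Annihilator (s : ℕ) (f : Monomial n → ℚ) : Set where
    field
      powers      : ∀ m i → k ≤ lookup m i → f m ≡ 0ℚ
      elementaries : ∀ m d → n < d ℕ.+ s → E (λ b → f (m · b)) (e n d) ≡ 0ℚ

  record Dual (s : ℕ) (a : Monomial n) : Set where
    field
      functional  : Monomial n → ℚ
      annihilates : Annihilator s functional
      normalised  : functional a ≡ 1ℚ
      triangular  : ∀ m → functional m ≡ 0ℚ ⊎ m ≼ a

open Annihilator
open Dual

-- With a · c = (0, ..., s - 1), the functional takes the coefficient of `m · c` in the Vandermonde
-- determinant. Its support consists of permutations, whose entries are below `s ≤ k`, and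
-- `s < d ℕ.+ s` says exactly that `d ≥ 1`. Cancelling `c` from `m · c ≼ a · c` gives triangularity.
dual-⊑ : ∀ {k s} → s ≤ k → {a : Monomial s} → a ⊑ staircaseᵛ 0 s → Dual k s a
dual-⊑ {k} {s} s≤k {a} a⊑ with c , ac≡ ← ⊑⇒∣ a⊑ = record
  { functional  = λ m → alt s (m · c)
  ; annihilates = record
    { powers = λ m i k≤m → case alt-support s (m · c) of λ where
        (inj₁ alt≡0)     → alt≡0
        (inj₂ (_ , mc<s)) → contradiction (ℕₚ.<-≤-trans (Allᵛₚ.lookup⁺ mc<s i) s≤k)
          (ℕₚ.≤⇒≯ (ℕₚ.≤-trans k≤m (ℕₚ.≤-trans (ℕₚ.m≤m+n (lookup m i) (lookup c i))
            (ℕₚ.≤-reflexive (sym (Vecₚ.lookup-zipWith ℕ._+_ i m c))))))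
    ; elementaries = λ m d s<d+s → trans
        (E-cong (λ b → cong (alt s) (·-right-comm m b c)) (e s d))
        (alt-elementary s (m · c) d (ℕₚ.+-cancelʳ-≤ s 1 d s<d+s))
    }
  ; normalised = trans (cong (alt s) ac≡) (alt-staircaseᵛ {s} {s} {0} refl)
  ; triangular = λ m → case alt-support s (m · c) of λ where
      (inj₁ alt≡0) → inj₁ alt≡0
      (inj₂ perm)  → inj₂ (·-cancelʳ-≼ m a c (subst (m · c ≼_) (sym ac≡) (permutation-≼ {r = 0} refl (m · c) perm)))
  }
  where
  ·-right-comm : ∀ (m b c : Monomial s) → (m · b) · c ≡ (m · c) · b
  ·-right-comm m b c = trans (·-assoc m b c) (trans (cong (m ·_) (·-comm b c)) (sym (·-assoc m c b)))

-- The new functional requires the exponent `j` at `p` and applies the old one to the remaining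
-- exponents. It vanishes on powers of `x p` from the `k`-th on because `j < k`; the other powers
-- are left to the old functional.
dual-insertAt : ∀ {k s n j} → j < k → (p : Fin (suc n)) {a : Monomial n} → Dual k s a →
  Dual k s (insertAt a p j)
dual-insertAt {k} {s} {n} {j} j<k p {a} dual = record
  { functional  = f
  ; annihilates = record
    { powers       = f-powers
    ; elementaries = f-elementaries
    }
  ; normalised = trans (f-≡ (insertAt a p j) (Vecₚ.insertAt-lookup a p j))
      (trans (cong (functional dual) (Vecₚ.removeAt-insertAt a p j)) (normalised dual))
  ; triangular = f-triangular
  }
  where
  f : Monomial (suc n) → ℚ
  f m = if does (lookup m p ℕₚ.≟ j) then functional dual (removeAt m p) else 0ℚ

  f-insertAt : ∀ m i → f (insertAt m p i) ≡ (if does (i ℕₚ.≟ j) then functional dual m else 0ℚ)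
  f-insertAt m i = cong₂ (λ i m → if does (i ℕₚ.≟ j) then functional dual m else 0ℚ)
    (Vecₚ.insertAt-lookup m p i) (Vecₚ.removeAt-insertAt m p i)

  f-≡ : ∀ m → lookup m p ≡ j → f m ≡ functional dual (removeAt m p)
  f-≡ m eq = cong (λ b → if b then functional dual (removeAt m p) else 0ℚ) (dec-true (lookup m p ℕₚ.≟ j) eq)

  f-≢ : ∀ m → lookup m p ≢ j → f m ≡ 0ℚ
  f-≢ m neq = cong (λ b → if b then functional dual (removeAt m p) else 0ℚ) (dec-false (lookup m p ℕₚ.≟ j) neq)

  f-powers : ∀ m i → k ≤ lookup m i → f m ≡ 0ℚ
  f-powers m i k≤m with lookup m p ℕₚ.≟ j | p Finₚ.≟ i
  ... | no  neq | _        = f-≢ m neq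
  ... | yes eq  | yes refl = contradiction (subst (_< k) (sym eq) j<k) (ℕₚ.≤⇒≯ k≤m)
  ... | yes eq  | no  p≢i  = trans (f-≡ m eq) (powers (annihilates dual) (removeAt m p) (punchOut p≢i)
    (subst (k ≤_) (sym (Vecₚ.removeAt-punchOut m p≢i)) k≤m))

  f-elementaries : ∀ m d → suc n < d ℕ.+ s → E (λ b → f (m · b)) (e (suc n) d) ≡ 0ℚ
  f-elementaries m d n< = trans (E-e-insertAt (λ b → f (m · b)) p d)
    (cong₂ ℚ._+_ (slice 1 (e⁻ n d) (lower d n<))
      (slice 0 (e n d) (elementaries (annihilates dual) m′ d (ℕₚ.<-trans (ℕₚ.n<1+n n) n<))))
    where
    m′ : Monomial n
    m′ = removeAt m p

    -- The degree drops by one together with the number of variables, so the bound d > n - s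
    -- survives.
    lower : ∀ d → suc n < d ℕ.+ s → E (λ b → functional dual (m′ · b)) (e⁻ n d) ≡ 0ℚ
    lower zero    _  = refl
    lower (suc d) n< = elementaries (annihilates dual) m′ d (s≤s⁻¹ n<)

    slice : ∀ i q → E (λ b → functional dual (m′ · b)) q ≡ 0ℚ → E (λ b → f (m · insertAt b p i)) q ≡ 0ℚ
    slice i q E≡0 = begin
      E (λ b → f (m · insertAt b p i)) q
        ≡⟨ E-cong (λ b → trans
             (cong f (trans (cong (_· insertAt b p i) (sym (Vecₚ.insertAt-removeAt m p)))
               (insertAt-· m′ b p (lookup m p) i)))
             (f-insertAt (m′ · b) (lookup m p ℕ.+ i))) q ⟩
      E (λ b → if does (lookup m p ℕ.+ i ℕₚ.≟ j) then functional dual (m′ · b) else 0ℚ) q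
        ≡⟨ choose (does (lookup m p ℕ.+ i ℕₚ.≟ j)) ⟩
      0ℚ ∎
      where
      -- All terms have the same exponent `lookup m p ℕ.+ i` at `p`, so a single test decides the
      -- whole sum.
      choose : ∀ c → E (λ b → if c then functional dual (m′ · b) else 0ℚ) q ≡ 0ℚ
      choose true  = E≡0
      choose false = E-zero q

  f-triangular : ∀ m → f m ≡ 0ℚ ⊎ m ≼ insertAt a p j
  f-triangular m with lookup m p ℕₚ.≟ j
  ... | no  neq = inj₁ (f-≢ m neq)
  ... | yes eq with triangular dual (removeAt m p)
  ...   | inj₁ ≡0 = inj₁ (trans (f-≡ m eq) ≡0)
  ...   | inj₂ ≼a = inj₂ (subst (_≼ insertAt a p j)
            (trans (cong (insertAt (removeAt m p) p) (sym eq)) (Vecₚ.insertAt-removeAt m p)) (insertAt-mono-≼ p j ≼a))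

-- Independence of the Artin monomials

data Insertion (k : ℕ) {s} (v : Monomial s) : ∀ {n} → Monomial n → Set where
  base   : Insertion k v v
  insert : ∀ {n j} {a : Monomial n} → j < k → (p : Fin (suc n)) → Insertion k v a → Insertion k v (insertAt a p j)

∷-insertion : ∀ {k s n} x {v : Monomial s} {a : Monomial n} → Insertion k v a → Insertion k (x ∷ v) (x ∷ a)
∷-insertion x base            = base
∷-insertion x (insert j<k p i) = insert j<k (suc p) (∷-insertion x i)

-- The exponents under the increasing sequence form `v`; those under an entry `c` are the inserted
-- ones, and they are below `suc c`.
staircase-insertion : ∀ {c r s q n} {a st : Monomial n} → Staircase c r s q st → a ⊑ st →
  ∃ λ v → v ⊑ staircaseᵛ r s × Insertion (suc c) v a
staircase-insertion []        []          = [] , [] , base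
staircase-insertion (next sh) (x≤r ∷ a⊑st) with v , v⊑ , i ← staircase-insertion sh a⊑st =
  _ ∷ v , x≤r ∷ v⊑ , ∷-insertion _ i
staircase-insertion (top sh)  (x≤c ∷ a⊑st) with v , v⊑ , i ← staircase-insertion sh a⊑st =
  v , v⊑ , insert (s≤s x≤c) zero i

dual-insertion : ∀ {k s n} {v : Monomial s} {a : Monomial n} → Dual k s v → Insertion k v a → Dual k s a
dual-insertion dual base            = dual
dual-insertion dual (insert j<k p i) = dual-insertAt j<k p (dual-insertion dual i)

-- The factor `m` is quantified so that the induction passes through `mulᴵ`: it absorbs the
-- monomials of the multiplier `r`.
annihilator-ideal : ∀ {n k} {f : Monomial n → ℚ} → k ≤ n → Annihilator k k f →
  ∀ {p} → Ideal (polynomialRing n) (Generators n k) p → ∀ m → E (λ b → f (m · b)) p ≡ 0ℚ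
annihilator-ideal {n} {k} {f} k≤n ann = go
  where
  go : ∀ {p} → Ideal (polynomialRing n) (Generators n k) p → ∀ m → E (λ b → f (m · b)) p ≡ 0ℚ
  go (generator (power i)) m = begin
    E (λ b → f (m · b)) (x i ^ᴾ k)  ≡⟨ cong (E (λ b → f (m · b))) (x^ i k) ⟩
    1ℚ ℚ.* f (m · unit i k) ℚ.+ 0ℚ
      ≡⟨ cong (λ u → 1ℚ ℚ.* u ℚ.+ 0ℚ) (powers ann (m · unit i k) i
           (⊑-unit i (subst (unit i k ⊑_) (·-comm (unit i k) m) (∣⇒⊑ (unit i k) m)))) ⟩
    0ℚ ∎
  go (generator (elementary d n-k<d d≤n)) m = elementaries ann m d
    (subst (_< d ℕ.+ k) (ℕₚ.m∸n+n≡m k≤n) (ℕₚ.+-monoˡ-< k (subst (_≤ d) (ℕₚ.+-comm (n ∸ k) 1) n-k<d)))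
  go zeroᴵ m = refl
  go (addᴵ {p} {q} p∈ q∈) m = trans (E-+ (λ b → f (m · b)) p q) (cong₂ ℚ._+_ (go p∈ m) (go q∈ m))
  go (mulᴵ r {p} p∈) m = begin
    E (λ b → f (m · b)) (r *ᴾ p)               ≡⟨ E-* (λ b → f (m · b)) r p ⟩
    E (λ a → E (λ b → f (m · (a · b))) p) r    ≡⟨ E-cong (λ a → trans (E-cong (λ b → cong f (sym (·-assoc m a b))) p)
                                                           (go p∈ (m · a))) r ⟩
    E (λ _ → 0ℚ) r                             ≡⟨ E-zero r ⟩
    0ℚ ∎
  go (respᴵ {p} {q} p≈q p∈) m = trans (sym (E-resp-≈ (λ b → f (m · b)) p≈q)) (go p∈ m)

E-weighted-cong : ∀ {n} {f g c : Monomial n → ℚ} L → (∀ {a} → a ∈ L → c a ℚ.* f a ≡ c a ℚ.* g a) →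
  E f (weighted c L) ≡ E g (weighted c L)
E-weighted-cong []      eq = refl
E-weighted-cong (a ∷ L) eq = cong₂ ℚ._+_ (eq (here refl)) (E-weighted-cong L (eq ∘ there))

-- Induction along `_≺_`. The functional dual to `a` kills the combination; the terms below `a` have
-- coefficient 0 by induction and those not `≼ a` have value 0 by triangularity, which leaves `c a`.
independent : ∀ {n k} → k ≤ n → {P : Monomial n → Set} → (∀ {a} → P a → Dual k k a) →
  ∀ (is : List (Monomial n)) → Unique is → (∀ {a} → a ∈ is → P a) →
  ∀ c → Ideal (polynomialRing n) (Generators n k) (linearCombination (Rᴹ n k) monomial c is) →
  ∀ {a} → a ∈ is → c a ≡ 0ℚ
independent {n} {k} k≤n dualOf is is! isP c c∈I {a} a∈is = go (≺-wellFounded a) a∈is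
  where
  go : ∀ {a} → Acc _≺_ a → a ∈ is → c a ≡ 0ℚ
  go {a} (acc rs) a∈is = begin
    c a                                 ≡⟨ coefficient-weighted-∈ c is! a∈is ⟨
    E (δ a) (weighted c is)             ≡⟨ E-weighted-cong is same ⟨
    E (functional φ) (weighted c is)    ≡⟨ E-linearCombination {k = k} (functional φ) c is ⟨
    E (functional φ) lc                 ≡⟨ E-cong (λ b → cong (functional φ) (·-identityˡ b)) lc ⟨
    E (λ b → functional φ (Vec.replicate n 0 · b)) lc ≡⟨ annihilator-ideal k≤n (annihilates φ) c∈I (Vec.replicate n 0) ⟩
    0ℚ                                  ∎
    where
    φ : Dual k k a
    φ = dualOf (isP a∈is)
    lc : Polynomial n
    lc = linearCombination (Rᴹ n k) monomial c is

    same : ∀ {b} → b ∈ is → c b ℚ.* functional φ b ≡ c b ℚ.* δ a b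
    same {b} b∈is with a ≟ᴹ b | triangular φ b
    ... | yes refl | _ = cong (c a ℚ.*_) (normalised φ)
    ... | no  a≢b  | inj₁ φb≡0        = cong (c b ℚ.*_) φb≡0
    ... | no  a≢b  | inj₂ (inj₁ refl) = contradiction refl a≢b
    ... | no  a≢b  | inj₂ (inj₂ b≺a)  = trans (≡0⇒*≡0 cb≡0) (sym (≡0⇒*≡0 cb≡0))
      where
      cb≡0 : c b ≡ 0ℚ
      cb≡0 = go (rs b≺a) b∈is

-- Spanning

private
  module P {n} = CommutativeRing (polynomialRing n)
  module PP {n} = RingProperties (P.ring {n})

-- The generators of I_{n,k,s}. In the induction `s` may exceed `n`, and then e_0 = 1 is among them;
-- for `d > n` the polynomial e_d is 0.
data Generatorsₛ (n k s : ℕ) : Pred (Polynomial n) 0ℓ where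
  power      : ∀ i → Generatorsₛ n k s (monomial (unit i k))
  elementary : ∀ d → n < d ℕ.+ s → Generatorsₛ n k s (e n d)

Iₛ : ∀ n k s → Pred (Polynomial n) 0ℓ
Iₛ n k s = Ideal (polynomialRing n) (Generatorsₛ n k s)

module _ {n : ℕ} where

  E⇒≈ : ∀ {p q : Polynomial n} → (∀ f → E f p ≡ E f q) → p ≈ᴾ q
  E⇒≈ E≡ = coefficientwise λ a → E≡ (δ a)

  -- The polynomials congruent, modulo the ideal of `G`, to a combination of monomials in `A`;
  -- `span-representative` extracts such a combination.
  data Span (G : Pred (Polynomial n) 0ℓ) (A : Pred (Monomial n) 0ℓ) : Pred (Polynomial n) 0ℓ where
    element : ∀ {c a} → A a → Span G A ((c , a) ∷ [])
    ideal   : ∀ {p} → Ideal (polynomialRing n) G p → Span G A p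
    sum     : ∀ {p q} → Span G A p → Span G A q → Span G A (p +ᴾ q)
    respˢ   : ∀ {p q} → p ≈ᴾ q → Span G A p → Span G A q

  module _ {G : Pred (Polynomial n) 0ℓ} where
    private module Q = CommutativeRing (quotientRing (polynomialRing n) G)

    ≈⇒≋ : ∀ {p q : Polynomial n} → p ≈ᴾ q → p Q.≈ q
    ≈⇒≋ {p} {q} p≈q = congruent (respᴵ (P.trans (P.sym (P.-‿inverseʳ q)) (P.+-congʳ (P.sym p≈q))) zeroᴵ)

    span-representative : ∀ {A : Pred (Monomial n) 0ℓ} {p} → Span G A p → ∃ λ q → All (A ∘ proj₂) q × p Q.≈ q
    span-representative (element Aa) = _ , Aa ∷ [] , Q.refl
    span-representative (ideal {p} p∈I) = [] , [] , congruent (respᴵ (P.sym (P.+-identityʳ p)) p∈I)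
    span-representative (sum s t) with q , Aq , p≋q ← span-representative s | q′ , Aq′ , p′≋q′ ← span-representative t =
      q ++ q′ , Allₚ.++⁺ Aq Aq′ , Q.+-cong p≋q p′≋q′
    span-representative (respˢ {p} {p′} p≈p′ s) with q , Aq , p≋q ← span-representative s =
      q , Aq , Q.trans (≈⇒≋ (P.sym p≈p′)) p≋q

-- Multiplication by powers of an inserted variable

module _ {n : ℕ} (p : Fin (suc n)) where

  private
    ι : ℕ → Polynomial n → Polynomial (suc n)
    ι = insertVariable p

  insertVariable-cong : ∀ j {q r : Polynomial n} → q ≈ᴾ r → ι j q ≈ᴾ ι j r
  insertVariable-cong j {q} {r} q≈r = E⇒≈ λ f → begin
    E f (ι j q)                        ≡⟨ E-insertVariable f p j q ⟩
    E (λ a → f (insertAt a p j)) q     ≡⟨ E-resp-≈ _ q≈r ⟩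
    E (λ a → f (insertAt a p j)) r     ≡⟨ E-insertVariable f p j r ⟨
    E f (ι j r)                        ∎

  insertVariable-* : ∀ i j (q r : Polynomial n) → ι i q *ᴾ ι j r ≈ᴾ ι (i ℕ.+ j) (q *ᴾ r)
  insertVariable-* i j q r = E⇒≈ λ f → begin
    E f (ι i q *ᴾ ι j r)                    ≡⟨ E-* f (ι i q) (ι j r) ⟩
    E (λ a → E (λ b → f (a · b)) (ι j r)) (ι i q)
      ≡⟨ E-insertVariable _ p i q ⟩
    E (λ a → E (λ b → f (insertAt a p i · b)) (ι j r)) q
      ≡⟨ E-cong (λ a → trans (E-insertVariable _ p j r) (E-cong (λ b → cong f (insertAt-· a b p i j)) r)) q ⟩
    E (λ a → E (λ b → f (insertAt (a · b) p (i ℕ.+ j))) r) q ≡⟨ E-* _ q r ⟨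
    E (λ a → f (insertAt a p (i ℕ.+ j))) (q *ᴾ r) ≡⟨ E-insertVariable f p (i ℕ.+ j) (q *ᴾ r) ⟨
    E f (ι (i ℕ.+ j) (q *ᴾ r))              ∎

  insertVariable-+ : ∀ j (q r : Polynomial n) → ι j (q +ᴾ r) ≡ ι j q +ᴾ ι j r
  insertVariable-+ j q r = Listₚ.map-++ _ q r

  insertVariable-neg : ∀ j (q : Polynomial n) → ι j (-ᴾ q) ≡ -ᴾ (ι j q)
  insertVariable-neg j []      = refl
  insertVariable-neg j (_ ∷ q) = cong (_ ∷_) (insertVariable-neg j q)

  -- The relation that drives the spanning argument. `ι-elementary` solves it for the first summand,
  -- `ι-elementary-low` for the second.
  insertVariable-*-e : ∀ j (r : Polynomial n) d →
    ι j r *ᴾ e (suc n) d ≈ᴾ ι (suc j) (r *ᴾ e⁻ n d) +ᴾ ι j (r *ᴾ e n d)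
  insertVariable-*-e j r d = E⇒≈ λ f → begin
    E f (ι j r *ᴾ e (suc n) d)
      ≡⟨ E-resp-≈ f (P.*-congˡ {x = ι j r} (e-insertVariable p d)) ⟩
    E f (ι j r *ᴾ (ι 1 (e⁻ n d) +ᴾ ι 0 (e n d)))
      ≡⟨ E-resp-≈ f (P.distribˡ (ι j r) (ι 1 (e⁻ n d)) (ι 0 (e n d))) ⟩
    E f (ι j r *ᴾ ι 1 (e⁻ n d) +ᴾ ι j r *ᴾ ι 0 (e n d))
      ≡⟨ E-resp-≈ f (P.+-cong (insertVariable-* j 1 r (e⁻ n d)) (insertVariable-* j 0 r (e n d))) ⟩
    E f (ι (j ℕ.+ 1) (r *ᴾ e⁻ n d) +ᴾ ι (j ℕ.+ 0) (r *ᴾ e n d))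
      ≡⟨ cong₂ (λ i i′ → E f (ι i (r *ᴾ e⁻ n d) +ᴾ ι i′ (r *ᴾ e n d))) (ℕₚ.+-comm j 1) (ℕₚ.+-identityʳ j) ⟩
    E f (ι (suc j) (r *ᴾ e⁻ n d) +ᴾ ι j (r *ᴾ e n d)) ∎

e≈0 : ∀ {n d} → n < d → e n d ≈ᴾ 0ᴾ
e≈0 {n} {d} n<d = coefficientwise λ a → E-e-zero (δ a) d λ S ∣S∣≡d →
  contradiction (∣p∣≤n S) (ℕₚ.<⇒≱ (subst (n <_) (sym ∣S∣≡d) n<d))

insertVariable-1 : ∀ {n} (p : Fin (suc n)) k → insertVariable p k 1ᴾ ≡ monomial (unit p k)
insertVariable-1 p k = cong monomial (go p)
  where
  go : ∀ {n} (p : Fin (suc n)) → insertAt (Vec.replicate n 0) p k ≡ unit p k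
  go         zero    = refl
  go {suc n} (suc p) = cong (0 ∷_) (go p)

module _ {n : ℕ} {q r s : Polynomial n} where

  moveˡ : q ≈ᴾ r +ᴾ s → q +ᴾ -ᴾ r ≈ᴾ s
  moveˡ q≈r+s = P.trans (P.+-congʳ (P.trans q≈r+s (P.+-comm r s)))
    (P.trans (P.+-assoc s r (-ᴾ r)) (P.trans (P.+-congˡ (P.-‿inverseʳ r)) (P.+-identityʳ s)))

  moveʳ : q ≈ᴾ r +ᴾ s → q +ᴾ -ᴾ s ≈ᴾ r
  moveʳ q≈r+s = P.trans (P.+-congʳ q≈r+s)
    (P.trans (P.+-assoc r s (-ᴾ s)) (P.trans (P.+-congˡ (P.-‿inverseʳ s)) (P.+-identityʳ r)))

-- Transport of ideals and spans to one more variable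

module _ {n k : ℕ} (p : Fin (suc n)) where

  private
    ι : ℕ → Polynomial n → Polynomial (suc n)
    ι = insertVariable p

  module _ {s : ℕ} where

    subᴵ : ∀ {q r : Polynomial (suc n)} → Iₛ (suc n) k s q → Iₛ (suc n) k s r → Iₛ (suc n) k s (q +ᴾ -ᴾ r)
    subᴵ {q} {r} q∈I r∈I = addᴵ q∈I (respᴵ (PP.-1*x≈-x r) (mulᴵ (-ᴾ 1ᴾ) r∈I))

    ι-powers : ∀ j r i → Iₛ (suc n) k s (ι j (r *ᴾ monomial (unit i k)))
    ι-powers j r i = respᴵ
      (P.trans (insertVariable-* p j 0 r (monomial (unit i k)))
        (P.reflexive (cong (λ j → ι j (r *ᴾ monomial (unit i k))) (ℕₚ.+-identityʳ j))))
      (mulᴵ (ι j r) (subst (λ a → Iₛ (suc n) k s (monomial a)) (sym (insertAt-unit p i k))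
        (generator (power (punchIn p i)))))

    ι-high : ∀ j q → k ≤ j → Iₛ (suc n) k s (ι j q)
    ι-high j q k≤j = respᴵ
      (P.trans (insertVariable-* p (j ∸ k) k q 1ᴾ)
        (P.trans (P.reflexive (cong (λ j → ι j (q *ᴾ 1ᴾ)) (ℕₚ.m∸n+n≡m k≤j)))
          (insertVariable-cong p j (P.*-identityʳ q))))
      (mulᴵ (ι (j ∸ k) q) (subst (Iₛ (suc n) k s) (sym (insertVariable-1 p k)) (generator (power p))))

    -- Each step trades one power of the new variable for one degree of e_d, modulo a generator in
    -- all variables. At `j = 0` the second bound reads `n < d`, where e_d is 0.
    ι-elementary : ∀ j r d → n < d ℕ.+ s → n < d ℕ.+ j → Iₛ (suc n) k s (ι j (r *ᴾ e n d))
    ι-elementary zero    r d n<d+s n<d+j = respᴵ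
      (P.sym (insertVariable-cong p 0 (P.trans (P.*-congˡ {x = r} (e≈0 (subst (n <_) (ℕₚ.+-identityʳ d) n<d+j)))
        (P.zeroʳ r)))) zeroᴵ
    ι-elementary (suc j) r d n<d+s n<d+j = respᴵ
      (moveʳ (insertVariable-*-e p j r (suc d)))
      (subᴵ (mulᴵ (ι j r) (generator (elementary (suc d) (s≤s n<d+s))))
            (ι-elementary j r (suc d) (ℕₚ.m≤n⇒m≤1+n n<d+s) (subst (n <_) (ℕₚ.+-suc d j) n<d+j)))

  module _ {s t : ℕ} {A : Pred (Monomial n) 0ℓ} {B : Pred (Monomial (suc n)) 0ℓ} (j : ℕ) where

    private
      S : Pred (Polynomial (suc n)) 0ℓ
      S = Span (Generatorsₛ (suc n) k s) B

    -- Only the elementary generators depend on how `j` compares with `s`, so their treatment is a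
    -- hypothesis. The cofactor `r` is quantified in order to absorb `mulᴵ`.
    ι-ideal : (∀ d → n < d ℕ.+ t → ∀ r → S (ι j (r *ᴾ e n d))) → ∀ {q} → Iₛ n k t q → ∀ r → S (ι j (r *ᴾ q))
    ι-ideal es (generator (power i))          r = ideal (ι-powers j r i)
    ι-ideal es (generator (elementary d n<)) r = es d n< r
    ι-ideal es zeroᴵ                          r = ideal (respᴵ (P.sym (insertVariable-cong p j (P.zeroʳ r))) zeroᴵ)
    ι-ideal es (addᴵ {q} {q′} q∈ q′∈)         r = respˢ
      (P.trans (P.reflexive (sym (insertVariable-+ p j (r *ᴾ q) (r *ᴾ q′))))
        (insertVariable-cong p j (P.sym (P.distribˡ r q q′))))
      (sum (ι-ideal es q∈ r) (ι-ideal es q′∈ r))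
    ι-ideal es (mulᴵ r′ {q} q∈)               r = respˢ
      (insertVariable-cong p j (P.*-assoc r r′ q)) (ι-ideal es q∈ (r *ᴾ r′))
    ι-ideal es (respᴵ q≈q′ q∈)                r = respˢ (insertVariable-cong p j (P.*-congˡ {x = r} q≈q′)) (ι-ideal es q∈ r)

    ι-span : (∀ d → n < d ℕ.+ t → ∀ r → S (ι j (r *ᴾ e n d))) → (∀ {a} → A a → B (insertAt a p j)) →
      ∀ {q} → Span (Generatorsₛ n k t) A q → S (ι j q)
    ι-span es A⇒B (element Aa)          = element (A⇒B Aa)
    ι-span es A⇒B (ideal {q} q∈I)       = respˢ (insertVariable-cong p j (P.*-identityˡ q)) (ι-ideal es q∈I 1ᴾ)
    ι-span es A⇒B (sum {q} {q′} sq sq′) = respˢ (P.reflexive (sym (insertVariable-+ p j q q′)))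
      (sum (ι-span es A⇒B sq) (ι-span es A⇒B sq′))
    ι-span es A⇒B (respˢ q≈q′ sq)       = respˢ (insertVariable-cong p j q≈q′) (ι-span es A⇒B sq)

    -- Modulo the generator e_d in all variables, the polynomial becomes a multiple of the next
    -- power of the new variable, which is assumed to be spanned already.
    ι-elementary-low : (∀ q → S (ι (suc j) q)) → ∀ d → suc n < d ℕ.+ s → ∀ r → S (ι j (r *ᴾ e n d))
    ι-elementary-low higher d n< r = respˢ (P.trans (P.+-congˡ
        (P.reflexive (insertVariable-neg p (suc j) (r *ᴾ e⁻ n d)))) (moveˡ (insertVariable-*-e p j r d)))
      (sum (ideal (mulᴵ (ι j r) (generator (elementary d n<)))) (higher (-ᴾ (r *ᴾ e⁻ n d))))

-- The exponent vectors below a shuffle of (0, …, s - 1) and (c, …, c).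
Artin : (c n s : ℕ) → Pred (Monomial n) 0ℓ
Artin c n s a = ∃₂ λ q st → Staircase c 0 s q st × a ⊑ st

insertAt-⊑ : ∀ {n} {a b : Vec ℕ n} p {i j} → a ⊑ b → i ≤ j → insertAt a p i ⊑ insertAt b p j
insertAt-⊑ zero    a⊑b         i≤j = i≤j ∷ a⊑b
insertAt-⊑ (suc p) (x≤y ∷ a⊑b) i≤j = x≤y ∷ insertAt-⊑ p a⊑b i≤j

-- `Staircase` grows at the front, whereas the spanning induction adds the last variable.
next-last : ∀ {c r m q n} {st : Vec ℕ n} → Staircase c r m q st →
  Staircase c r (suc m) q (insertAt st (fromℕ n) (r ℕ.+ m))
next-last {r = r} []        rewrite ℕₚ.+-identityʳ r = next []
next-last {r = r} (next {m = m} sh) rewrite ℕₚ.+-suc r m = next (next-last sh)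
next-last         (top sh)  = top (next-last sh)

top-last : ∀ {c r m q n} {st : Vec ℕ n} → Staircase c r m q st →
  Staircase c r m (suc q) (insertAt st (fromℕ n) c)
top-last []        = top []
top-last (next sh) = next (top-last sh)
top-last (top sh)  = top (top-last sh)

artin-next : ∀ {c n s a j} → j ≤ s → Artin c n s a → Artin c (suc n) (suc s) (insertAt a (fromℕ n) j)
artin-next j≤s (q , st , sh , a⊑st) = q , _ , next-last sh , insertAt-⊑ _ a⊑st j≤s

artin-top : ∀ {c n s a j} → j ≤ c → Artin c n s a → Artin c (suc n) s (insertAt a (fromℕ n) j)
artin-top j≤c (q , st , sh , a⊑st) = suc q , _ , top-last sh , insertAt-⊑ _ a⊑st j≤c

-- Induction on `n`, splitting off the last variable. For each of its exponents j, from high to low,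
-- the cofactor is spanned by the induction hypothesis, whose parameter is `s` when j is at least
-- `s` and one less otherwise.
span-artin : ∀ c n s (w : Polynomial n) → Span (Generatorsₛ n (suc c) s) (Artin c n s) w
span-artin c zero    zero    []             = ideal zeroᴵ
span-artin c zero    zero    ((q , []) ∷ w) = sum (element (0 , [] , [] , [])) (span-artin c zero zero w)
-- The generator e_0 is 1, so the ideal contains every polynomial.
span-artin c zero    (suc s) w              = ideal (respᴵ (P.*-identityʳ w) (mulᴵ w (generator (elementary 0 ℕ.z<s))))
span-artin c (suc n) s       w              = terms w
  where
  p : Fin (suc n)
  p = fromℕ n

  S : Pred (Polynomial (suc n)) 0ℓ
  S = Span (Generatorsₛ (suc n) (suc c) s) (Artin c (suc n) s)

  descend : ∀ s j → j ≤ c → let S = Span (Generatorsₛ (suc n) (suc c) s) (Artin c (suc n) s) in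
    (∀ w → S (insertVariable p (suc j) w)) → ∀ w → S (insertVariable p j w)
  descend s j j≤c higher w with s ℕₚ.≤? j
  -- The last exponent is placed under an entry `c`, and `s` is kept.
  ... | yes s≤j = ι-span p j (λ d n< r → ideal (ι-elementary p j r d n< (ℕₚ.≤-trans n< (ℕₚ.+-monoʳ-≤ d s≤j))))
                    (artin-top j≤c) (span-artin c n s w)
  descend zero    j j≤c higher w | no s≰j = contradiction z≤n s≰j
  -- The last exponent is at most `s`, the final value of the increasing sequence (0, ..., s), and
  -- is placed under it.
  descend (suc s) j j≤c higher w | no s≰j = ι-span p j
    (λ d n< → ι-elementary-low p {t = s} {A = Artin c n s} j higher d
      (subst (suc n <_) (sym (ℕₚ.+-suc d s)) (s≤s n<)))
    (artin-next (s≤s⁻¹ (ℕₚ.≰⇒> s≰j))) (span-artin c n s w)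

  -- The fuel `i` bounds suc c - j: the recursion raises `j` until the power of the last variable
  -- lies in the ideal.
  slice : ∀ i j → suc c ≤ i ℕ.+ j → ∀ w → S (insertVariable p j w)
  slice zero    j c<j   w = ideal (ι-high p j w c<j)
  slice (suc i) j c<i+j w with suc c ℕₚ.≤? j
  ... | yes c<j = ideal (ι-high p j w c<j)
  ... | no  c≮j = descend s j (s≤s⁻¹ (ℕₚ.≰⇒> c≮j))
      (slice i (suc j) (subst (suc c ≤_) (sym (ℕₚ.+-suc i j)) c<i+j)) w

  terms : ∀ w → S w
  terms []            = ideal zeroᴵ
  terms ((q , a) ∷ w) = sum
    (subst (λ a → S ((q , a) ∷ [])) (Vecₚ.insertAt-removeAt a p)
      (slice (suc c) (lookup a p) (ℕₚ.m≤m+n (suc c) (lookup a p)) ((q , removeAt a p) ∷ [])))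
    (terms w)

-- Transfer to `𝒜`, `ℳ` and `R n k`

ideal-specialise : ∀ {n k} → k ≤ n → ∀ {p} → Iₛ n k k p → Ideal (polynomialRing n) (Generators n k) p
ideal-specialise {n} {k} k≤n = go
  where
  go : ∀ {p} → Iₛ n k k p → Ideal (polynomialRing n) (Generators n k) p
  go (generator (power i))            = subst (Ideal _ _) (x^ i k) (generator (power i))
  go (generator (elementary d n<d+k)) with d ℕₚ.≤? n
  ... | yes d≤n = generator (elementary d (subst (_≤ d) (ℕₚ.+-comm 1 (n ∸ k)) (ℕₚ.+-cancelʳ-< k (n ∸ k) d
                    (subst (_< d ℕ.+ k) (sym (ℕₚ.m∸n+n≡m k≤n)) n<d+k))) d≤n)
  ... | no  d≰n = respᴵ (P.sym (e≈0 (ℕₚ.≰⇒> d≰n))) zeroᴵ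
  go zeroᴵ            = zeroᴵ
  go (addᴵ p∈ q∈)     = addᴵ (go p∈) (go q∈)
  go (mulᴵ r p∈)      = mulᴵ r (go p∈)
  go (respᴵ p≈q p∈)   = respᴵ p≈q (go p∈)

staircase-length : ∀ {c r m q n} {st : Vec ℕ n} → Staircase c r m q st → m ℕ.+ q ≡ n
staircase-length []                = refl
staircase-length (next sh)         = cong suc (staircase-length sh)
staircase-length {m = m} (top {q = q} sh) = trans (ℕₚ.+-suc m q) (cong suc (staircase-length sh))

𝒜⇒staircase : ∀ {n k a} → 𝒜 n k a → ∃ λ st → Staircase (k ∸ 1) 0 k (n ∸ k) st × a ⊑ st
𝒜⇒staircase {n} {k} (st , sh , a⊑st) =
  st , fromInterleaving 0 k (n ∸ k) st
    (subst (λ l → Interleaving l (List.replicate (n ∸ k) (k ∸ 1)) (toList st)) (upTo≡range k) sh) , a⊑st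

staircase⇒𝒜 : ∀ {n k a st} → Staircase (k ∸ 1) 0 k (n ∸ k) st → a ⊑ st → 𝒜 n k a
staircase⇒𝒜 {n} {k} {st = st} sh a⊑st =
  st , subst (λ l → Interleaving l (List.replicate (n ∸ k) (k ∸ 1)) (toList st)) (sym (upTo≡range k))
    (toInterleaving sh) , a⊑st

-- The number `q` of constant entries is forced by the length of the staircase.
artin⇒𝒜 : ∀ {n c a} → Artin c n (suc c) a → 𝒜 n (suc c) a
artin⇒𝒜 {n} {c} (q , st , sh , a⊑st) = staircase⇒𝒜 (subst (λ q → Staircase c 0 (suc c) q st) q≡ sh) a⊑st
  where
  q≡ : q ≡ n ∸ suc c
  q≡ = trans (sym (ℕₚ.m+n∸m≡n (suc c) q)) (cong (_∸ suc c) (staircase-length sh))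

-- Starts from the Vandermonde functional in the `k` variables that carry the increasing sequence,
-- then inserts the remaining exponents.
𝒜⇒dual : ∀ {n k a} → 1 ≤ k → 𝒜 n k a → Dual k k a
𝒜⇒dual {k = suc c} _ a∈𝒜 with st , sh , a⊑st ← 𝒜⇒staircase a∈𝒜 with v , v⊑ , i ← staircase-insertion sh a⊑st =
  dual-insertion (dual-⊑ ℕₚ.≤-refl v⊑) i

𝒜⊆ℳ : ∀ {n k a} → 1 ≤ k → 𝒜 n k a → ℳ n k a
𝒜⊆ℳ {n} {suc c} {a} _ a∈𝒜 with st , sh , a⊑st ← 𝒜⇒staircase a∈𝒜 =
  (λ S ∣S∣≡ skip∣a → skip≰staircase ℕₚ.≤-refl z≤n S sh
     (ℕₚ.≤-reflexive (trans (ℕₚ.+-comm 1 (n ∸ suc c)) (sym ∣S∣≡)))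
     (Pointwise.trans ℕₚ.≤-trans (∣-monomial {a = skip S} {a} skip∣a) a⊑st)) ,
  (λ i xᵏ∣a → ℕₚ.<⇒≱ (ℕ.s≤s (ℕₚ.≤-trans (Pointwise.lookup a⊑st i) (staircase-≤ ℕₚ.≤-refl sh i)))
     (⊑-unit i (∣-monomial {a = unit i (suc c)} {a} (subst (_∣ᴾ monomial a) (x^ i (suc c)) xᵏ∣a))))

ℳ⊆𝒜 : ∀ {n k a} → 1 ≤ k → k ≤ n → ℳ n k a → 𝒜 n k a
ℳ⊆𝒜 {n} {suc c} {a} _ k≤n (noSkip , noPower)
  with st , sh , a⊑st ← greedyStaircase (suc c) (n ∸ suc c) {1} {1} ℕₚ.≤-refl refl (sym (ℕₚ.m+[n∸m]≡n k≤n)) a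
         (λ i → ℕₚ.≮⇒≥ λ c<a → noPower i (subst (_∣ᴾ monomial a) (sym (x^ i (suc c))) (monomial-∣ (unit-⊑ i c<a))))
         (λ S ∣S∣≡ skip⊑a → noSkip S (trans ∣S∣≡ (ℕₚ.+-comm 1 (n ∸ suc c))) (monomial-∣ skip⊑a))
  = staircase⇒𝒜 sh a⊑st

𝒜-isBasis : ∀ {n k} → 1 ≤ k → k ≤ n → IsBasis (Rᴹ n k) (𝒜 n k) monomial
𝒜-isBasis {n} {k} 1≤k k≤n = record
  { linearlyIndependent = λ is is! is⊆𝒜 c c≋0 → independent k≤n (𝒜⇒dual 1≤k) is is! (All.lookup is⊆𝒜) c
      (respᴵ (P.+-identityʳ _) (_≋_.difference c≋0))
  ; spanning = spanning 1≤k k≤n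
  }
  where
  spanning : ∀ {k} → 1 ≤ k → k ≤ n → (w : Polynomial n) → ∃₂ λ (is : List (Monomial n)) (c : Monomial n → ℚ) →
    All (𝒜 n k) is × CommutativeRing._≈_ (R n k) w (linearCombination (Rᴹ n k) monomial c is)
  spanning {suc c} _ k≤n w
    with q , q∈ , congruent w≋q ← span-representative (span-artin c n (suc c) w) =
    -- The representative `q` may repeat a monomial, while a linear combination has one scalar per
    -- monomial; hence the coefficients of `q` on its distinct monomials.
    monomials q , (λ a → coefficient a q) , All.tabulate artinian ,
    Rₖ.trans {w} {q} (congruent (ideal-specialise k≤n w≋q)) (≈⇒≋ (P.trans (collect q)
      (E⇒≈ λ f → sym (E-linearCombination {k = suc c} f (λ a → coefficient a q) (monomials q)))))
    where
    module Rₖ = CommutativeRing (R n (suc c))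

    artinian : ∀ {a} → a ∈ monomials q → 𝒜 n (suc c) a
    artinian a∈ with t , t∈q , refl ← ∈-map⁻ proj₂ (∈-deduplicate⁻ _≟ᴹ_ (List.map proj₂ q) a∈) =
      artin⇒𝒜 (All.lookup q∈ t∈q)

theorem4p13 : (n k : ℕ) → 1 ≤ k → k ≤ n →
    (𝒜 n k ≐ ℳ n k) × IsBasis (Rᴹ n k) (𝒜 n k) monomial
theorem4p13 n k 1≤k k≤n = (𝒜⊆ℳ 1≤k , ℳ⊆𝒜 1≤k k≤n) , 𝒜-isBasis 1≤k k≤n
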